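{- The set of all integer partitions is a disjoint union of Boolean classes under diagonal-block flips. A class with $k$ diagonal blocks contains exactly $2^k$ partitions, all of the same size, and contains a unique member of $\mathcal P^+$. In other words, $$\sum_{\lambda\in\mathcal P^+}2^{\kappa(\lambda)}q^{|\lambda|}=\frac{1}{(q;q)_\infty},\qquad (q;q)_\infty=\prod_{j\ge1}(1-q^j).$$
   Context: Let $\lambda$ be a partition with conjugate $\lambda'$ and Durfee size $d$ (the side of the largest square contained in the Young diagram of $\lambda$). Put $\alpha_i=\lambda_i-d$ and $\beta_i=\lambda_i'-d$ for $1\le i\le d$. Then $\alpha=(\alpha_1,\dots,\alpha_d)$ (the upper wing) and $\beta=(\beta_1,\dots,\beta_d)$ (the lower wing, reflected in the main diagonal) are partitions with at most $d$ parts, $|\lambda|=d^2+|\alpha|+|\beta|$, and $(d,\alpha,\beta)$ determines $\lambda$. Put $I_i=\min(\alpha_i,\beta_i)$ and $U_i=\max(\alpha_i,\beta_i)$. The edge-connected components of the skew diagram $U/I$ (cells adjacent when they share an edge) are the diagonal blocks of $\lambda$; $\kappa(\lambda)$ is their number. Every diagonal block lies entirely in $\alpha\setminus\beta$ or entirely in $\beta\setminus\alpha$ (as sets of cells); flipping a diagonal block means moving all its cells from the one of $\alpha,\beta$ that contains it to the other, keeping $d$ and everything else fixed. The class of $\lambda$ is the set of all partitions obtained from $\lambda$ by flipping arbitrary subsets of its diagonal blocks (equivalently, all partitions with the same data $d$, $I$, $U$); "Boolean" means that the blocks can be flipped independently, each choice of wing for each block giving a partition. The successive ranks of $\lambda$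 are $\sigma_i(\lambda)=\lambda_i-\lambda_i'=\alpha_i-\beta_i$, $1\le i\le d$. $\mathcal P^+$ is the set of all partitions whose successive ranks are all nonnegative (including the empty partition). -}

module Defs where

open import Data.Bool.Base using (if_then_else_)
open import Data.Empty using (⊥-elim)
open import Data.Fin.Base using (Fin; zero; suc)
import Data.Fin.Properties as Fin
open import Data.Fin.Subset using (Subset) renaming (_∈_ to _∈ˢ_)
open import Data.Integer.Base as ℤ using (ℤ; +_; 0ℤ; 1ℤ)
import Data.Integer.Properties as ℤ
open import Data.List.Base using (List; []; _∷_; length; lookup; map; filter; concat; concatMap; foldr; upTo; applyUpTo; cartesianProduct; deduplicate; mapMaybe)
import Data.List.Properties as List
open import Data.Nat.ListAction using (sum)
open import Data.List.Membership.Propositional using (find; lose) renaming (_∈_ to _∈ˡ_)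
open import Data.List.Membership.Propositional.Properties using (∈-filter⁺; ∈-filter⁻; ∈-cartesianProduct⁺; ∈-upTo⁺; ∈-map⁺; ∈-concatMap⁺; ∈-concat⁺; ∈-concat⁻; ∈-deduplicate⁺; ∈-lookup)
open import Data.List.Relation.Unary.All as All using (All; []; _∷_; all?)
import Data.List.Relation.Unary.All.Properties as All
open import Data.List.Relation.Unary.AllPairs as AllPairs using (AllPairs; []; _∷_)
import Data.List.Relation.Unary.AllPairs.Properties as AllPairs
open import Data.List.Relation.Unary.Any as Any using (Any; here; there; any?)
import Data.List.Relation.Unary.Any.Properties as Any
open import Data.List.Relation.Unary.Linked as Linked using (Linked; linked?)
open import Data.List.Relation.Unary.Unique.Propositional using (Unique)
import Data.List.Relation.Unary.Unique.Propositional.Properties as Unique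
import Data.List.Relation.Unary.Unique.DecPropositional.Properties as DecUnique
open import Data.Maybe.Base using (Maybe; just; nothing)
import Data.Maybe.Relation.Unary.Any as Maybe
open import Data.Nat.Base using (ℕ; zero; suc; _+_; _*_; _∸_; _^_; _⊓_; _⊔_; _≤_; _<_; _≥_; z≤n; s≤s)
open import Data.Nat.Properties using (_≟_; _≤?_; _<?_; _≥?_; allUpTo?; ≤-irrelevant; ≤-trans; ≤-<-trans; <-≤-trans; <-irrefl; ≰⇒>; m≤m+n; m≤n+m; m∸n≤m; ⊔-lub; +-mono-≤; m≤n⇒m<n∨m≡n; m>n⇒m∸n≢0; n∸n≡0)
open import Data.Product.Base using (∃; ∃-syntax; _×_; _,_; proj₁; proj₂)
open import Data.Product using (∃!)
open import Data.Sum.Base using (_⊎_; inj₁; inj₂)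
open import Function.Base using (_∘_)
open import Function.Bundles using (_⇔_; mk⇔; Equivalence)
open import Relation.Binary.Construct.Closure.ReflexiveTransitive as Star using (Star; ε; _◅_; _◅◅_)
open import Relation.Binary.Core using (Rel)
open import Relation.Binary.Definitions using (DecidableEquality; Symmetric) renaming (Decidable to Decidable₂)
open import Relation.Binary.PropositionalEquality using (_≡_; _≢_; refl; sym; trans; cong; cong₂; subst)
open import Relation.Nullary using (¬_; Dec; yes; no; does; ¬?; _×-dec_; _⊎-dec_)
open import Relation.Nullary.Decidable using (map′; dec-false)
open import Relation.Unary using (Pred; Decidable; _∈_; _∉_; _⊆_; _≐_; _∩_; _∪_; _∖_)
open import Level using (0ℓ)

-- Row and column indices start at 0 throughout, so that
-- row p i is λ_{i+1} and col p j is λ′_{j+1}.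

record Partition : Set where
  constructor mkPartition
  field
    parts      : List ℕ
    decreasing : Linked _≥_ parts
    positive   : All (0 <_) parts

open Partition public

size : Partition → ℕ
size p = sum (parts p)

nth : List ℕ → ℕ → ℕ
nth []       _       = 0
nth (x ∷ xs) zero    = x
nth (x ∷ xs) (suc i) = nth xs i

row : Partition → ℕ → ℕ
row p i = nth (parts p) i

col : Partition → ℕ → ℕ
col p j = length (filter (j <?_) (parts p))

Cell : Set
Cell = ℕ × ℕ

Young : Partition → Pred Cell 0ℓ
Young p (i , j) = j < row p i

Square : Partition → ℕ → Set
Square p d = ∀ {i} → i < d → ∀ {j} → j < d → (i , j) ∈ Young p

square? : ∀ p → Decidable (Square p)
square? p d = allUpTo? (λ i → allUpTo? (λ j → j <? row p i) d) d

greatest : {P : Pred ℕ 0ℓ} → Decidable P → ℕ → ℕ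
greatest P? zero    = 0
greatest P? (suc n) = if does (P? (suc n)) then suc n else greatest P? n

-- A square in the diagram of p has at most length (parts p) rows;
-- see durfee-square and durfee-largest below.
durfee : Partition → ℕ
durfee p = greatest (square? p) (length (parts p))

-- In α, β, I, U and rank only the values at indices below the Durfee
-- size are used.

α β I U : Partition → ℕ → ℕ
α p i = row p i ∸ durfee p
β p i = col p i ∸ durfee p
I p i = α p i ⊓ β p i
U p i = α p i ⊔ β p i

rank : Partition → ℕ → ℤ
rank p i = (+ row p i) ℤ.- (+ col p i)

𝒫⁺ : Pred Partition 0ℓ
𝒫⁺ p = ∀ {i} → i < durfee p → 0ℤ ℤ.≤ rank p i

𝒫⁺? : Decidable 𝒫⁺
𝒫⁺? p = allUpTo? (λ i → 0ℤ ℤ.≤? rank p i) (durfee p)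

Diagram : ℕ → (ℕ → ℕ) → Pred Cell 0ℓ
Diagram d f (i , j) = i < d × j < f i

diagram? : ∀ d f → Decidable (Diagram d f)
diagram? d f (i , j) = (i <? d) ×-dec (j <? f i)

Skew : Partition → Pred Cell 0ℓ
Skew p = Diagram (durfee p) (U p) ∖ Diagram (durfee p) (I p)

skew? : ∀ p → Decidable (Skew p)
skew? p c = diagram? (durfee p) (U p) c ×-dec ¬? (diagram? (durfee p) (I p) c)

data Wing : Set where
  upper lower : Wing

opposite : Wing → Wing
opposite upper = lower
opposite lower = upper

-- The lower wing is reflected in the main diagonal, as in the definition of β.
wing : Wing → Partition → Pred Cell 0ℓ
wing upper p = Diagram (durfee p) (α p)
wing lower p = Diagram (durfee p) (β p)

-- A path inside S.  The empty path also relates a point outside S to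
-- itself; the relation is used for points of S only.
Connected : {A : Set} → Rel A 0ℓ → Pred A 0ℓ → Rel A 0ℓ
Connected _~_ S = Star (λ x y → x ∈ S × y ∈ S × x ~ y)

-- Adding x merges the components that contain a neighbour of x.
components : {A : Set} {_~_ : Rel A 0ℓ} → Decidable₂ _~_ → List A → List (List A)
components _~?_ []       = []
components _~?_ (x ∷ xs) =
  (x ∷ concat (filter (any? (x ~?_)) (components _~?_ xs)))
  ∷ filter (¬? ∘ any? (x ~?_)) (components _~?_ xs)

Adjacent : Rel Cell 0ℓ
Adjacent (i , j) (k , l) = (i ≡ k × (suc j ≡ l ⊎ suc l ≡ j))
                         ⊎ (j ≡ l × (suc i ≡ k ⊎ suc k ≡ i))

adjacent? : Decidable₂ Adjacent
adjacent? (i , j) (k , l) = ((i ≟ k) ×-dec ((suc j ≟ l) ⊎-dec (suc l ≟ j)))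
                      ⊎-dec ((j ≟ l) ×-dec ((suc i ≟ k) ⊎-dec (suc k ≟ i)))

-- The grid is large enough to contain every cell of the skew diagram.
skewCells : Partition → List Cell
skewCells p = filter (skew? p) (cartesianProduct (upTo (durfee p)) (upTo (size p)))

-- See block-cover, block-nonempty and block-connected below.
blocks : Partition → List (List Cell)
blocks p = components adjacent? (skewCells p)

κ : Partition → ℕ
κ p = length (blocks p)

Block : (p : Partition) → Fin (κ p) → Pred Cell 0ℓ
Block p b c = c ∈ˡ lookup (blocks p) b

BlockCells : (p : Partition) → Subset (κ p) → Pred Cell 0ℓ
BlockCells p s c = ∃[ b ] b ∈ˢ s × c ∈ Block p b

-- Each cell of a flipped block lies in exactly one wing of p, so swapping
-- the wings on these cells moves it to the other one.
record Flip (p : Partition) (s : Subset (κ p)) (r : Partition) : Set where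
  field
    same-durfee : durfee r ≡ durfee p
    flip-wing   : ∀ w → wing w r ≐
                  (wing w p ∖ BlockCells p s) ∪ (wing (opposite w) p ∩ BlockCells p s)

Class : Partition → Pred Partition 0ℓ
Class p r = ∃[ s ] Flip p s r

-- In r, every block b of p lies in wing w b and is disjoint from the
-- other wing.
Placed : (p : Partition) → (Fin (κ p) → Wing) → Pred Partition 0ℓ
Placed p w r = ∀ b → Block p b ⊆ wing (w b) r ∖ wing (opposite (w b)) r

record Boolean (p : Partition) : Set where
  field
    independent : ∀ s → ∃! _≡_ (Flip p s)
    choice      : ∀ (w : Fin (κ p) → Wing) → ∃! _≡_ (Class p ∩ Placed p w)

HasCardinality : {A : Set} → Pred A 0ℓ → ℕ → Set
HasCardinality P n = ∃[ xs ] Unique xs × length xs ≡ n × (∀ x → x ∈ˡ xs ⇔ x ∈ P)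

partition? : (xs : List ℕ) → Dec (Linked _≥_ xs × All (0 <_) xs)
partition? xs = linked? _≥?_ xs ×-dec all? (0 <?_) xs

toPartition : List ℕ → Maybe Partition
toPartition xs with partition? xs
... | yes (d , q) = just (mkPartition xs d q)
... | no  _       = nothing

parts-injective : ∀ {p r} → parts p ≡ parts r → p ≡ r
parts-injective {mkPartition xs d q} {mkPartition .xs d′ q′} refl =
  cong₂ (mkPartition xs) (Linked.irrelevant ≤-irrelevant d d′) (All.irrelevant ≤-irrelevant q q′)

_≟ᴾ_ : DecidableEquality Partition
p ≟ᴾ r = map′ parts-injective (cong parts) (List.≡-dec _≟_ (parts p) (parts r))

boundedLists : ℕ → ℕ → List (List ℕ)
boundedLists m zero    = [] ∷ []
boundedLists m (suc k) = [] ∷ concatMap (λ x → map (x ∷_) (boundedLists m k)) (upTo (suc m))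

-- Deduplicating makes uniqueness immediate.  See partitionsOf-unique
-- and ∈-partitionsOf below.
partitionsOf : ℕ → List Partition
partitionsOf n =
  filter (λ p → size p ≟ n) (deduplicate _≟ᴾ_ (mapMaybe toPartition (boundedLists n n)))

-- Formal power series in q: the function sends n to the coefficient of q^n.

PowerSeries : Set
PowerSeries = ℕ → ℤ

infixl 7 _⊛_

sumℤ : List ℤ → ℤ
sumℤ = foldr ℤ._+_ 0ℤ

_⊛_ : PowerSeries → PowerSeries → PowerSeries
(f ⊛ g) n = sumℤ (applyUpTo (λ k → f k ℤ.* g (n ∸ k)) (suc n))

q^_ : ℕ → PowerSeries
(q^ j) n = if does (n ≟ j) then 1ℤ else 0ℤ

1-q^_ : ℕ → PowerSeries
(1-q^ j) n = (q^ 0) n ℤ.- (q^ j) n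

⟨q⟩ : ℕ → PowerSeries
⟨q⟩ zero    = q^ 0
⟨q⟩ (suc m) = ⟨q⟩ m ⊛ (1-q^ suc m)

-- The factors with j > n do not affect the coefficient of q^n; see
-- ⟨q⟩-stable below.
⟨q⟩∞ : PowerSeries
⟨q⟩∞ n = ⟨q⟩ n n

-- The coefficient of q^n collects the finitely many λ in 𝒫⁺ of size n.
𝒫⁺-series : PowerSeries
𝒫⁺-series n = + sum (map (λ p → 2 ^ κ p) (filter 𝒫⁺? (partitionsOf n)))

greatest-≤ : {P : Pred ℕ 0ℓ} (P? : Decidable P) → P 0 → ∀ n → P (greatest P? n)
greatest-≤ P? p0 zero = p0
greatest-≤ P? p0 (suc n) with P? (suc n)
... | yes p = p
... | no  _ = greatest-≤ P? p0 n

greatest-≥ : {P : Pred ℕ 0ℓ} (P? : Decidable P) → ∀ n {m} → m ≤ n → P m → m ≤ greatest P? n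
greatest-≥ P? zero    m≤n Pm = m≤n
greatest-≥ P? (suc n) m≤n Pm with P? (suc n)
... | yes _ = m≤n
... | no ¬p with m≤n⇒m<n∨m≡n m≤n
...   | inj₁ (s≤s m≤n′) = greatest-≥ P? n m≤n′ Pm
...   | inj₂ refl       = ⊥-elim (¬p Pm)

nth-length : ∀ xs → nth xs (length xs) ≡ 0
nth-length []       = refl
nth-length (x ∷ xs) = nth-length xs

square-length : ∀ p {d} → Square p d → d ≤ length (parts p)
square-length p {d} sq with d ≤? length (parts p)
... | yes d≤l = d≤l
... | no  d≰l with subst (0 <_) (nth-length (parts p)) (sq (≰⇒> d≰l) (≤-<-trans z≤n (≰⇒> d≰l)))
...   | ()

durfee-square : ∀ p → Square p (durfee p)
durfee-square p = greatest-≤ (square? p) (λ ()) (length (parts p))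

durfee-largest : ∀ p {d} → Square p d → d ≤ durfee p
durfee-largest p sq = greatest-≥ (square? p) (length (parts p)) (square-length p (λ {i} → sq {i})) (λ {i} → sq {i})

module _ {A : Set} {_~_ : Rel A 0ℓ} (_~?_ : Decidable₂ _~_) (~-sym : Symmetric _~_) where

  Separated : Rel (List A) 0ℓ
  Separated b b′ = ∀ y z → y ∈ˡ b → z ∈ˡ b′ → y ≢ z × ¬ (y ~ z)

  separated-sym : Symmetric Separated
  separated-sym s y z y∈ z∈ = proj₁ (s z y z∈ y∈) ∘ sym , proj₂ (s z y z∈ y∈) ∘ ~-sym

  private
    comps : List A → List (List A)
    comps = components _~?_

    Linkedᴸ : List A → Rel A 0ℓ
    Linkedᴸ xs = Connected _~_ (_∈ˡ xs)

    weaken : ∀ {x xs y z} → Linkedᴸ xs y z → Linkedᴸ (x ∷ xs) y z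
    weaken = Star.map (λ (y∈ , z∈ , e) → there y∈ , there z∈ , e)

    AllLinked : List A → Pred (List A) 0ℓ
    AllLinked xs b = ∀ y z → y ∈ˡ b → z ∈ˡ b → Linkedᴸ xs y z

    reverse : ∀ {xs y z} → Linkedᴸ xs y z → Linkedᴸ xs z y
    reverse = Star.reverse (λ (y∈ , z∈ , e) → z∈ , y∈ , ~-sym e)

  components-complete : ∀ {xs y} → y ∈ˡ xs → Any (y ∈ˡ_) (comps xs)
  components-complete (here refl) = here (here refl)
  components-complete {x ∷ xs} {y} (there y∈xs) = go (comps xs) (components-complete y∈xs)
    where
    touches? : Decidable (Any (x ~_))
    touches? = any? (x ~?_)
    go : ∀ bs → Any (y ∈ˡ_) bs → Any (y ∈ˡ_) ((x ∷ concat (filter touches? bs)) ∷ filter (¬? ∘ touches?) bs)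
    go bs y∈ with Any.filter⁺ touches? y∈
    ... | inj₁ y∈f = here (there (∈-concat⁺ y∈f))
    ... | inj₂ ¬t = there (Any.map proj₁ (other bs y∈ ¬t))
      where
      other : ∀ bs (y∈ : Any (y ∈ˡ_) bs) → ¬ Any (x ~_) (Any.lookup y∈) →
              Any (λ b → y ∈ˡ b × ¬ Any (x ~_) b) (filter (¬? ∘ touches?) bs)
      other (b ∷ bs) (here y∈b) ¬t with touches? b
      ... | yes t = ⊥-elim (¬t t)
      ... | no  n = here (y∈b , n)
      other (b ∷ bs) (there y∈) ¬t with touches? b
      ... | yes _ = other bs y∈ ¬t
      ... | no  _ = there (other bs y∈ ¬t)

  components-sound : ∀ xs → All (All (_∈ˡ xs)) (comps xs)
  components-sound [] = []
  components-sound (x ∷ xs) =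
    (here refl ∷ All.concat⁺ (All.filter⁺ touches? ih)) ∷ All.filter⁺ (¬? ∘ touches?) ih
    where
    touches? : Decidable (Any (x ~_))
    touches? = any? (x ~?_)
    ih : All (All (_∈ˡ (x ∷ xs))) (comps xs)
    ih = All.map (All.map there) (components-sound xs)

  components-nonempty : ∀ xs → All (λ b → ∃ (_∈ˡ b)) (comps xs)
  components-nonempty [] = []
  components-nonempty (x ∷ xs) =
    (x , here refl) ∷ All.filter⁺ (¬? ∘ any? (x ~?_)) (components-nonempty xs)

  components-linked : ∀ xs → All (AllLinked xs) (comps xs)
  components-linked [] = []
  components-linked (x ∷ xs) =
    (λ y z y∈ z∈ → reverse (fromHead y∈) ◅◅ fromHead z∈) ∷
    All.filter⁺ (¬? ∘ touches?) (All.map (λ l y z y∈ z∈ → weaken (l y z y∈ z∈)) ih)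
    where
    touches? : Decidable (Any (x ~_))
    touches? = any? (x ~?_)
    ih : All (AllLinked xs) (comps xs)
    ih = components-linked xs
    reach : ∀ {b z} → All (_∈ˡ xs) b → Any (x ~_) b → AllLinked xs b → z ∈ˡ b → Linkedᴸ (x ∷ xs) x z
    reach s t l z∈b with find t
    ... | y , y∈b , x~y = (here refl , there (All.lookup s y∈b) , x~y) ◅ weaken (l y _ y∈b z∈b)
    fromHead : ∀ {z} → z ∈ˡ (x ∷ concat (filter touches? (comps xs))) → Linkedᴸ (x ∷ xs) x z
    fromHead (here refl) = ε
    fromHead (there z∈) with find (∈-concat⁻ (filter touches? (comps xs)) z∈)
    ... | b , b∈ , z∈b with ∈-filter⁻ touches? {xs = comps xs} b∈
    ...   | b∈comps , t = reach (All.lookup (components-sound xs) b∈comps) t (All.lookup ih b∈comps) z∈b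

  components-separated : ∀ {xs} → Unique xs → AllPairs Separated (comps xs)
  components-separated [] = []
  components-separated {x ∷ xs} (x∉xs ∷ xs!) =
    All.tabulate headSep ∷ AllPairs.filter⁺ (¬? ∘ touches?) ih
    where
    touches? : Decidable (Any (x ~_))
    touches? = any? (x ~?_)
    ih : AllPairs Separated (comps xs)
    ih = components-separated xs!
    sep-split : ∀ {bs} → AllPairs Separated bs → ∀ {b b′} → b ∈ˡ bs → b′ ∈ˡ bs →
                Any (x ~_) b → ¬ Any (x ~_) b′ → Separated b b′
    sep-split (s ∷ ss) (here refl) (here refl) t ¬t = ⊥-elim (¬t t)
    sep-split (s ∷ ss) (here refl) (there b′∈) t ¬t = All.lookup s b′∈
    sep-split (s ∷ ss) (there b∈)  (here refl) t ¬t = separated-sym (All.lookup s b∈)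
    sep-split (s ∷ ss) (there b∈)  (there b′∈) t ¬t = sep-split ss b∈ b′∈ t ¬t
    headSep : ∀ {b′} → b′ ∈ˡ filter (¬? ∘ touches?) (comps xs) →
              Separated (x ∷ concat (filter touches? (comps xs))) b′
    headSep b′∈ y z y∈ z∈ with ∈-filter⁻ (¬? ∘ touches?) {xs = comps xs} b′∈
    headSep b′∈ y z (here refl) z∈ | b′∈comps , ¬t =
      All.lookup x∉xs (All.lookup (All.lookup (components-sound xs) b′∈comps) z∈) , λ x~z → ¬t (lose z∈ x~z)
    headSep b′∈ y z (there y∈)  z∈ | b′∈comps , ¬t with find (∈-concat⁻ (filter touches? (comps xs)) y∈)
    ... | b , b∈ , y∈b with ∈-filter⁻ touches? {xs = comps xs} b∈
    ...   | b∈comps , t = sep-split ih b∈comps b′∈comps t ¬t y z y∈b z∈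

  lookup-separated : ∀ {bs} → AllPairs Separated bs → ∀ i j → i ≢ j → Separated (lookup bs i) (lookup bs j)
  lookup-separated (s ∷ ss) zero    zero    i≢j = ⊥-elim (i≢j refl)
  lookup-separated (s ∷ ss) zero    (suc j) i≢j = All.lookup s (∈-lookup j)
  lookup-separated (s ∷ ss) (suc i) zero    i≢j = separated-sym (All.lookup s (∈-lookup i))
  lookup-separated (s ∷ ss) (suc i) (suc j) i≢j = lookup-separated ss i j (i≢j ∘ cong suc)

  component-cover : ∀ {xs y} → y ∈ˡ xs ⇔ (∃[ b ] y ∈ˡ lookup (comps xs) b)
  component-cover {xs} = mk⇔
    (λ y∈ → Any.index (components-complete y∈) , Any.lookup-index (components-complete y∈))
    (λ (b , y∈) → All.lookup (All.lookup (components-sound xs) (∈-lookup b)) y∈)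

  component-connected : ∀ {xs} → Unique xs → ∀ {b b′ y z} →
                        y ∈ˡ lookup (comps xs) b → z ∈ˡ lookup (comps xs) b′ →
                        b ≡ b′ ⇔ Connected _~_ (_∈ˡ xs) y z
  component-connected {xs} xs! {b} {b′} {y} {z} y∈ z∈ = mk⇔
    (λ { refl → All.lookup (components-linked xs) (∈-lookup b) y z y∈ z∈ })
    (λ c → same c y∈)
    where
    sep : ∀ i j → i ≢ j → Separated (lookup (comps xs) i) (lookup (comps xs) j)
    sep = lookup-separated (components-separated xs!)
    same : ∀ {b y} → Linkedᴸ xs y z → y ∈ˡ lookup (comps xs) b → b ≡ b′
    same {b} ε y∈ with b Fin.≟ b′
    ... | yes e = e
    ... | no  n = ⊥-elim (proj₁ (sep b b′ n _ _ y∈ z∈) refl)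
    same {b} ((_ , w∈ , y~w) ◅ c) y∈ with components-complete w∈
    ... | w∈b″ with b Fin.≟ Any.index w∈b″
    ...   | yes refl = same c (Any.lookup-index w∈b″)
    ...   | no  n    = ⊥-elim (proj₂ (sep b (Any.index w∈b″) n _ _ y∈ (Any.lookup-index w∈b″)) y~w)

adjacent-sym : Symmetric Adjacent
adjacent-sym (inj₁ (e , inj₁ f)) = inj₁ (sym e , inj₂ f)
adjacent-sym (inj₁ (e , inj₂ f)) = inj₁ (sym e , inj₁ f)
adjacent-sym (inj₂ (e , inj₁ f)) = inj₂ (sym e , inj₂ f)
adjacent-sym (inj₂ (e , inj₂ f)) = inj₂ (sym e , inj₁ f)

nth≤sum : ∀ xs i → nth xs i ≤ sum xs
nth≤sum []       i       = z≤n
nth≤sum (x ∷ xs) zero    = m≤m+n x (sum xs)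
nth≤sum (x ∷ xs) (suc i) = ≤-trans (nth≤sum xs i) (m≤n+m (sum xs) x)

length≤sum : ∀ {xs} → All (0 <_) xs → length xs ≤ sum xs
length≤sum []         = z≤n
length≤sum (0<x ∷ ps) = +-mono-≤ 0<x (length≤sum ps)

U≤size : ∀ p i → U p i ≤ size p
U≤size p i = ⊔-lub
  (≤-trans (m∸n≤m (row p i) (durfee p)) (nth≤sum (parts p) i))
  (≤-trans (m∸n≤m (col p i) (durfee p))
    (≤-trans (List.length-filter (i <?_) (parts p)) (length≤sum (positive p))))

skewCells-unique : ∀ p → Unique (skewCells p)
skewCells-unique p = Unique.filter⁺ (skew? p)
  (Unique.cartesianProduct⁺ (Unique.upTo⁺ (durfee p)) (Unique.upTo⁺ (size p)))

∈-skewCells : ∀ p {c} → c ∈ˡ skewCells p ⇔ c ∈ Skew p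
∈-skewCells p = mk⇔
  (λ c∈ → proj₂ (∈-filter⁻ (skew? p) {xs = cartesianProduct (upTo (durfee p)) (upTo (size p))} c∈))
  (λ { s@((i<d , j<U) , _) → ∈-filter⁺ (skew? p)
    (∈-cartesianProduct⁺ (∈-upTo⁺ i<d) (∈-upTo⁺ (<-≤-trans j<U (U≤size p _)))) s })

block-cover : ∀ p {c} → c ∈ Skew p ⇔ (∃[ b ] c ∈ Block p b)
block-cover p = mk⇔ (to component-cover′ ∘ from (∈-skewCells p)) (to (∈-skewCells p) ∘ from component-cover′)
  where
  open Equivalence using (to; from)
  component-cover′ : ∀ {c} → c ∈ˡ skewCells p ⇔ (∃[ b ] c ∈ Block p b)
  component-cover′ = component-cover adjacent? adjacent-sym

block-nonempty : ∀ p b → ∃ (Block p b)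
block-nonempty p b = All.lookup (components-nonempty adjacent? adjacent-sym (skewCells p)) (∈-lookup b)

block-connected : ∀ p {b b′ c c′} → c ∈ Block p b → c′ ∈ Block p b′ →
                  b ≡ b′ ⇔ Connected Adjacent (Skew p) c c′
block-connected p c∈ c′∈ = mk⇔ (there′ ∘ to conn) (from conn ∘ back)
  where
  open Equivalence using (to; from)
  conn = component-connected adjacent? adjacent-sym (skewCells-unique p) c∈ c′∈
  there′ : ∀ {c c′} → Connected Adjacent (_∈ˡ skewCells p) c c′ → Connected Adjacent (Skew p) c c′
  there′ = Star.map (λ (x∈ , y∈ , e) → to (∈-skewCells p) x∈ , to (∈-skewCells p) y∈ , e)
  back : ∀ {c c′} → Connected Adjacent (Skew p) c c′ → Connected Adjacent (_∈ˡ skewCells p) c c′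
  back = Star.map (λ (x∈ , y∈ , e) → from (∈-skewCells p) x∈ , from (∈-skewCells p) y∈ , e)

∈-boundedLists : ∀ {m} k xs → length xs ≤ k → All (_≤ m) xs → xs ∈ˡ boundedLists m k
∈-boundedLists zero    []       _ _ = here refl
∈-boundedLists (suc k) []       _ _ = here refl
∈-boundedLists {m} (suc k) (x ∷ xs) (s≤s l) (x≤m ∷ b) =
  there (∈-concatMap⁺ (λ y → map (y ∷_) (boundedLists m k))
    (lose (∈-upTo⁺ (s≤s x≤m)) (∈-map⁺ (x ∷_) (∈-boundedLists k xs l b))))

all≤sum : ∀ xs → All (_≤ sum xs) xs
all≤sum []       = []
all≤sum (x ∷ xs) = m≤m+n x (sum xs) ∷ All.map (λ y≤ → ≤-trans y≤ (m≤n+m (sum xs) x)) (all≤sum xs)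

toPartition-parts : ∀ p → toPartition (parts p) ≡ just p
toPartition-parts p with partition? (parts p)
... | yes _ = cong just (parts-injective refl)
... | no  n = ⊥-elim (n (decreasing p , positive p))

partitionsOf-unique : ∀ n → Unique (partitionsOf n)
partitionsOf-unique n = Unique.filter⁺ (λ p → size p ≟ n)
  (DecUnique.deduplicate-! _≟ᴾ_ (mapMaybe toPartition (boundedLists n n)))

∈-partitionsOf : ∀ {n p} → p ∈ˡ partitionsOf n ⇔ size p ≡ n
∈-partitionsOf {n} {p} = mk⇔ to from
  where
  to : p ∈ˡ partitionsOf n → size p ≡ n
  to p∈ = proj₂ (∈-filter⁻ (λ r → size r ≟ n)
    {xs = deduplicate _≟ᴾ_ (mapMaybe toPartition (boundedLists n n))} p∈)
  from : size p ≡ n → p ∈ˡ partitionsOf n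
  from refl = ∈-filter⁺ (λ r → size r ≟ n) (∈-deduplicate⁺ _≟ᴾ_
    (Any.mapMaybe⁺ toPartition (boundedLists n n)
      (Any.map⁺ (Any.map (λ { refl → subst (Maybe.Any (p ≡_)) (sym (toPartition-parts p)) (Maybe.just refl) })
        (∈-boundedLists n (parts p) (length≤sum (positive p)) (all≤sum (parts p))))))) refl

sumℤ-head : ∀ f n → (∀ k → k < n → f k ≡ 0ℤ) → sumℤ (applyUpTo f (suc n)) ≡ f n
sumℤ-head f zero    z = ℤ.+-identityʳ (f 0)
sumℤ-head f (suc n) z = trans (cong (ℤ._+ sumℤ (applyUpTo (f ∘ suc) (suc n))) (z 0 (s≤s z≤n)))
  (trans (ℤ.+-identityˡ _) (sumℤ-head (f ∘ suc) n (λ k k<n → z (suc k) (s≤s k<n))))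

q^-≢ : ∀ {j n} → n ≢ j → (q^ j) n ≡ 0ℤ
q^-≢ {j} {n} n≢j = cong (if_then 1ℤ else 0ℤ) (dec-false (n ≟ j) n≢j)

⊛-1-q^ : ∀ f {j n} → n < j → (f ⊛ (1-q^ j)) n ≡ f n
⊛-1-q^ f {j} {n} n<j = trans (sumℤ-head (λ k → f k ℤ.* (1-q^ j) (n ∸ k)) n other) last
  where
  small : ∀ {i} → i ≤ n → (1-q^ j) i ≡ (q^ 0) i
  small {i} i≤n = trans (cong (λ z → (q^ 0) i ℤ.- z) (q^-≢ {j} {i} (λ { refl → <-irrefl refl (≤-<-trans i≤n n<j) }))) (ℤ.+-identityʳ _)
  other : ∀ k → k < n → f k ℤ.* (1-q^ j) (n ∸ k) ≡ 0ℤ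
  other k k<n = trans
    (cong (f k ℤ.*_) (trans (small (m∸n≤m n k)) (q^-≢ (m>n⇒m∸n≢0 k<n)))) (ℤ.*-zeroʳ (f k))
  last : f n ℤ.* (1-q^ j) (n ∸ n) ≡ f n
  last = trans (cong (f n ℤ.*_) (trans (small (m∸n≤m n n)) (cong (q^ 0) (n∸n≡0 n)))) (ℤ.*-identityʳ (f n))

⟨q⟩-stable : ∀ {m n} → n ≤ m → ⟨q⟩ m n ≡ ⟨q⟩∞ n
⟨q⟩-stable {zero}  {zero} _ = refl
⟨q⟩-stable {suc m} {n} n≤m with m≤n⇒m<n∨m≡n n≤m
... | inj₁ n<1+m@(s≤s n≤m′) = trans (⊛-1-q^ (⟨q⟩ m) n<1+m) (⟨q⟩-stable n≤m′)
... | inj₂ refl             = refl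

{-# OPTIONS --safe #-}

-- The wings of a partition of Durfee size d are two arbitrary down-closed sets
-- of cells with d rows.  Two adjacent cells of the skew diagram U / I lie in
-- the same wing, since each of them lies in exactly one wing and one of the
-- two cells is below the other; so each diagonal block lies in one wing.
-- Flipping blocks keeps both wings down-closed, for the same reason, and it
-- keeps the intersection I and the union U of the wings.  Conversely a
-- partition with the same d, I and U is determined by the wing it chooses for
-- each block.  Membership in 𝒫⁺ means that every block lies in the upper wing.
-- Summing 2 ^ κ over 𝒫⁺ therefore counts all partitions of n, and Euler's
-- product follows from P m = P (m - 1) + q ^ m P m, where P m counts the
-- partitions with parts at most m.

module Submission where

open import Defs
open import Data.Nat.Base using (_^_)
open import Data.Product using (∃!; _×_)
open import Data.Sum.Base using (_⊎_)
open import Relation.Binary.PropositionalEquality using (_≡_; _≗_)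
open import Relation.Unary using (_∈_; _≐_; _⊥_; _∩_)

import Algebra.Properties.CommutativeSemigroup as CommutativeSemigroup
import Algebra.Properties.Ring as Ring
open import Data.Fin.Base using (Fin; zero; suc)
import Data.Fin.Properties as Fin
open import Data.Fin.Subset using (Subset; inside; outside) renaming (_∈_ to _∈ˢ_; _∉_ to _∉ˢ_)
import Data.Fin.Subset.Properties as Subset
open import Data.Integer.Base as ℤ using (ℤ; 0ℤ)
import Data.Integer.Properties as ℤ
open import Data.Integer.Solver using (module +-*-Solver)
open import Data.List.Base using (List; []; _∷_; lookup; _++_; length; map; filter; concatMap; applyUpTo)
import Data.List.Properties as List
import Data.List.Membership.DecPropositional as DecMembership
open import Data.List.Membership.Propositional using (find; lose) renaming (_∈_ to _∈ˡ_)
open import Data.List.Membership.Propositional.Properties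
  using (∈-++⁺ˡ; ∈-++⁺ʳ; ∈-++⁻; ∈-map⁺; ∈-map⁻; ∈-filter⁺; ∈-filter⁻; ∈-concatMap⁺; ∈-concatMap⁻)
open import Data.List.Membership.Propositional.Properties.WithK using (unique∧set⇒bag)
open import Data.List.Relation.Binary.BagAndSetEquality using (∼bag⇒↭)
open import Data.List.Relation.Binary.Permutation.Propositional.Properties using (↭-length)
open import Data.List.Relation.Unary.All as All using (All; []; _∷_)
import Data.List.Relation.Unary.All.Properties as All
open import Data.List.Relation.Unary.Any using (here; there)
open import Data.List.Relation.Unary.AllPairs using ([]; _∷_)
open import Data.List.Relation.Unary.Unique.Propositional using (Unique)
import Data.List.Relation.Unary.Unique.Propositional.Properties as Unique
open import Data.List.Relation.Unary.Linked as Linked using (Linked; []; [-]; _∷_)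
import Data.List.Relation.Unary.Linked.Properties as Linked
open import Data.Nat.Base
  using (ℕ; zero; suc; _+_; _*_; _∸_; _⊓_; _⊔_; _≤_; _<_; _≥_; _≤′_; ≤′-reflexive; ≤′-step; z≤n; s≤s; s≤s⁻¹)
open import Data.Nat.ListAction using (sum)
open import Data.Nat.Properties
import Data.Product.Properties as Product
open import Data.Vec.Base using ([]; _∷_; here; there)
open import Data.Vec.Properties using (∷-injectiveʳ)
open import Data.Product.Base using (swap; ∃-syntax; _,_; proj₁; proj₂)
open import Data.Sum.Base as Sum using (inj₁; inj₂; [_,_]′)
open import Function.Base using (_∘_; id; case_of_)
open import Function.Bundles using (_⇔_; mk⇔; Equivalence)
open import Level using (0ℓ)
open import Relation.Binary.Construct.Closure.ReflexiveTransitive as Star using (ε; _◅_)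
open import Relation.Binary.Definitions using (DecidableEquality)
open import Relation.Binary.PropositionalEquality using (refl; sym; trans; cong; cong₂; subst; module ≡-Reasoning)
open import Relation.Nullary using (¬_; Dec; yes; no; ¬?; contradiction; _×-dec_; _⊎-dec_; _→-dec_)
open import Relation.Nullary.Decidable using (map′; decidable-stable; toSum)
open import Relation.Unary using (Pred; Decidable; _∉_; _⊆_; _∪_; _∖_)
open import Relation.Unary.Properties using (≐-trans)

open CommutativeSemigroup +-commutativeSemigroup using (x∙yz≈y∙xz) renaming (interchange to +-interchange)
open Ring ℤ.+-*-ring using (x[y-z]≈xy-xz; [y-z]x≈yx-zx)
open Equivalence using (to; from)

-- Initial segments of the natural numbers and down-closed sets of cells

-- Searching downwards from `n`, the first index that satisfies `P` is the last one that does, so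
-- `P` holds exactly below its successor.
threshold : {P : Pred ℕ 0ℓ} → Decidable P → (∀ {m n} → m ≤ n → P n → P m) →
            ∀ {n} → ¬ P n → ∃[ m ] P ≐ (_< m)
threshold P? down {zero}  ¬P = 0 , (λ Pj → contradiction (down z≤n Pj) ¬P) , λ ()
threshold P? down {suc n} ¬P with P? n
... | no ¬Pn = threshold P? down ¬Pn
... | yes Pn = suc n , (λ Pj → ≰⇒> (λ n<j → ¬P (down n<j Pj))) , (λ { (s≤s j≤n) → down j≤n Pn })

-- Inclusions of diagrams become inequalities between row lengths in this way; it is enough to test
-- the largest number below `m`.
<-extensional : ∀ {m n} → (_< m) ⊆ (_< n) → m ≤ n
<-extensional {zero}  f = z≤n
<-extensional {suc m} f = f ≤-refl

<-∸⇔ : ∀ {m n o} → m < n ∸ o ⇔ m + o < n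
<-∸⇔ {m} {n} {o} = mk⇔
  (λ m< → m≤o∸n⇒m+n≤o (suc m) {o} {n} (<⇒≤ (m∸n≢0⇒n<m (λ e → contradiction (subst (m <_) e m<) λ ()))) m<)
  (m+n≤o⇒m≤o∸n (suc m))

DownClosed : Pred Cell 0ℓ → Set
DownClosed S = ∀ {i j k l} → k ≤ i → l ≤ j → S (i , j) → S (k , l)

-- Flipping is controlled only between adjacent cells, so down-closure has to be reduced to single
-- steps up and to the left.
stepwise-downClosed : ∀ {S} → (∀ {i j} → S (suc i , j) → S (i , j)) →
                      (∀ {i j} → S (i , suc j) → S (i , j)) → DownClosed S
stepwise-downClosed {S} up left k≤i l≤j s = rows (≤⇒≤′ k≤i) (columns (≤⇒≤′ l≤j) s)
  where
  rows : ∀ {i j k} → k ≤′ i → S (i , j) → S (k , j)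
  rows (≤′-reflexive refl) s = s
  rows (≤′-step k≤i)       s = rows k≤i (up s)
  columns : ∀ {i j l} → l ≤′ j → S (i , j) → S (i , l)
  columns (≤′-reflexive refl) s = s
  columns (≤′-step l≤j)       s = columns l≤j (left s)

-- Partitions and their Young diagrams

nth-tail : ∀ {xs} → Linked _≥_ xs → ∀ i → nth xs (suc i) ≤ nth xs i
nth-tail []          i       = z≤n
nth-tail [-]         i       = z≤n
nth-tail (x≥y ∷ ys)  zero    = x≥y
nth-tail (x≥y ∷ ys)  (suc i) = nth-tail ys i

nth-antitone : ∀ {xs} → Linked _≥_ xs → ∀ {k i} → k ≤ i → nth xs i ≤ nth xs k
nth-antitone {xs} xs↘ k≤i = go (≤⇒≤′ k≤i)
  where
  go : ∀ {k i} → k ≤′ i → nth xs i ≤ nth xs k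
  go (≤′-reflexive refl) = ≤-refl
  go (≤′-step k≤i)       = ≤-trans (nth-tail xs↘ _) (go k≤i)

-- In a decreasing list the entries above `j` form a prefix, so their number tells which indices
-- carry them. If the head is not above `j`, no entry is.
nth-conjugate : ∀ {xs} → Linked _≥_ xs → ∀ i j → j < nth xs i ⇔ i < length (filter (j <?_) xs)
nth-conjugate {[]}     _   i j = mk⇔ (λ ()) (λ ())
nth-conjugate {x ∷ xs} xs↘ i j with j <? x
... | no  j≮x rewrite List.filter-reject (j <?_) {x} {xs} j≮x = mk⇔
  (λ j< → contradiction (<-≤-trans j< (nth-antitone xs↘ {0} {i} z≤n)) j≮x)
  (λ i< → contradiction (<-≤-trans (from (nth-conjugate (Linked.tail xs↘) i j) i<)
                                   (nth-antitone xs↘ {0} {suc i} z≤n)) j≮x)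
... | yes j<x rewrite List.filter-accept (j <?_) {x} {xs} j<x = go i
  where
  go : ∀ i → j < nth (x ∷ xs) i ⇔ i < suc (length (filter (j <?_) xs))
  go zero    = mk⇔ (λ _ → s≤s z≤n) (λ _ → j<x)
  go (suc i) = mk⇔ (s≤s ∘ to ih) (from ih ∘ s≤s⁻¹)
    where ih = nth-conjugate (Linked.tail xs↘) i j

-- Positive entries differ from the default value 0 of `nth`, so the values also determine the
-- length.
nth-injective : ∀ {xs ys} → All (0 <_) xs → All (0 <_) ys → (∀ i → nth xs i ≡ nth ys i) → xs ≡ ys
nth-injective []         []         eq = refl
nth-injective []         (0<y ∷ _)  eq = contradiction (eq 0) (<⇒≢ 0<y)
nth-injective (0<x ∷ _)  []         eq = contradiction (sym (eq 0)) (<⇒≢ 0<x)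
nth-injective (_ ∷ 0<xs) (_ ∷ 0<ys) eq = cong₂ _∷_ (eq 0) (nth-injective 0<xs 0<ys (eq ∘ suc))

nth-applyUpTo : ∀ f n → (∀ {i} → n ≤ i → f i ≡ 0) → ∀ i → nth (applyUpTo f n) i ≡ f i
nth-applyUpTo f zero    z i       = sym (z z≤n)
nth-applyUpTo f (suc n) z zero    = refl
nth-applyUpTo f (suc n) z (suc i) = nth-applyUpTo (f ∘ suc) n (z ∘ s≤s) i

row-col : ∀ p i j → j < row p i ⇔ i < col p j
row-col p = nth-conjugate (decreasing p)

young-downClosed : ∀ p → DownClosed (Young p)
young-downClosed p k≤i l≤j j< = ≤-<-trans l≤j (<-≤-trans j< (nth-antitone (decreasing p) k≤i))

young-injective : ∀ {p r} → Young p ≐ Young r → p ≡ r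
young-injective {p} {r} (p⊆r , r⊆p) = parts-injective (nth-injective (positive p) (positive r)
  (λ i → ≤-antisym (<-extensional p⊆r) (<-extensional r⊆p)))

-- Each part is the threshold of a row of `S`, and the number of parts is the threshold of column 0.
-- The index `n` bounds all these searches.
young-surjective : ∀ {S} → Decidable S → DownClosed S → ∀ {n} → (n , 0) ∉ S → (0 , n) ∉ S →
                   ∃[ p ] Young p ≐ S
young-surjective {S} S? down {n} ¬rows ¬cols = mkPartition (applyUpTo f h)
  (Linked.applyUpTo⁺₂ f h (λ i → <-extensional (λ {j} → to (f⇔ i j) ∘ down (n≤1+n i) ≤-refl ∘ from (f⇔ (suc i) j))))
  (All.applyUpTo⁺₁ f h (λ {i} i<h → to (f⇔ i 0) (proj₂ (proj₂ height) i<h))) ,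
  (λ {(i , j)} j< → from (f⇔ i j) (subst (j <_) (nth-f i) j<)) ,
  (λ {(i , j)} s → subst (j <_) (sym (nth-f i)) (to (f⇔ i j) s))
  where
  height = threshold (λ i → S? (i , 0)) (λ k≤i → down k≤i ≤-refl) ¬rows
  h = proj₁ height
  width : ∀ i → ∃[ m ] (λ j → S (i , j)) ≐ (_< m)
  width i = threshold (λ j → S? (i , j)) (down ≤-refl) (¬cols ∘ down z≤n ≤-refl)
  f : ℕ → ℕ
  f i = proj₁ (width i)
  f⇔ : ∀ i j → S (i , j) ⇔ j < f i
  f⇔ i j = mk⇔ (proj₁ (proj₂ (width i))) (proj₂ (proj₂ (width i)))
  -- From index `h` on, the default value 0 is correct: a nonempty row `i` would put `(i , 0)` into
  -- `S`.
  nth-f : ∀ i → nth (applyUpTo f h) i ≡ f i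
  nth-f = nth-applyUpTo f h (λ {i} h≤i → n≤0⇒n≡0 (≮⇒≥ (λ 0<f →
    <-irrefl refl (<-≤-trans (proj₁ (proj₂ height) (from (f⇔ i 0) 0<f)) h≤i))))

-- The decomposition into the Durfee square and two wings

_≟ʷ_ : (v w : Wing) → v ≡ w ⊎ opposite v ≡ w
upper ≟ʷ upper = inj₁ refl
upper ≟ʷ lower = inj₂ refl
lower ≟ʷ upper = inj₂ refl
lower ≟ʷ lower = inj₁ refl

opposite-involutive : ∀ w → opposite (opposite w) ≡ w
opposite-involutive upper = refl
opposite-involutive lower = refl

-- Places a cell of a wing in the Young diagram: the upper wing to the right of the Durfee square,
-- the lower wing reflected and below it.
embed : ℕ → Wing → Cell → Cell
embed d upper (i , j) = i , j + d
embed d lower (i , j) = j + d , i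

-- With this corner the diagram would contain a square of side `suc (durfee p)`.
durfee-corner : ∀ p → (durfee p , durfee p) ∉ Young p
durfee-corner p y = <-irrefl refl (durfee-largest p {suc (durfee p)}
  (λ { (s≤s i≤d) (s≤s j≤d) → young-downClosed p i≤d j≤d y }))

durfee-unique : ∀ p {d} → (∀ {i j} → i < d → j < d → (i , j) ∈ Young p) → (d , d) ∉ Young p → durfee p ≡ d
durfee-unique p {d} sq corner = ≤-antisym
  (≮⇒≥ (λ d<D → corner (durfee-square p d<D d<D)))
  (durfee-largest p (λ i<d j<d → sq i<d j<d))

wing-embed : ∀ p w {c} → c ∈ wing w p ⇔ (proj₁ c < durfee p × embed (durfee p) w c ∈ Young p)
wing-embed p upper {i , j} = mk⇔ (λ (i< , j<) → i< , to <-∸⇔ j<) (λ (i< , y) → i< , from <-∸⇔ y)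
wing-embed p lower {i , j} = mk⇔
  (λ (i< , j<) → i< , from (row-col p (j + durfee p) i) (to <-∸⇔ j<))
  (λ (i< , y) → i< , from <-∸⇔ (to (row-col p (j + durfee p) i) y))

wing? : ∀ w p → Decidable (wing w p)
wing? upper p = diagram? (durfee p) (α p)
wing? lower p = diagram? (durfee p) (β p)

wing-row : ∀ w p {c} → c ∈ wing w p → proj₁ c < durfee p
wing-row w p c∈ = proj₁ (to (wing-embed p w) c∈)

wing-downClosed : ∀ w p → DownClosed (wing w p)
wing-downClosed w p k≤i l≤j c∈ with to (wing-embed p w) c∈
... | i< , y = from (wing-embed p w) (≤-<-trans k≤i i< , shrink w k≤i l≤j y)
  where
  shrink : ∀ w {i j k l} → k ≤ i → l ≤ j →
           embed (durfee p) w (i , j) ∈ Young p → embed (durfee p) w (k , l) ∈ Young p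
  shrink upper k≤i l≤j = young-downClosed p k≤i (+-monoˡ-≤ (durfee p) l≤j)
  shrink lower k≤i l≤j = young-downClosed p (+-monoˡ-≤ (durfee p) l≤j) k≤i

-- A cell lies in the Durfee square, to its right, below it, or diagonally beyond it. The middle two
-- regions are the wings, and the last one is empty by `durfee-corner`.
wings-⊆ : ∀ {p r} → durfee p ≡ durfee r → (∀ w → wing w p ⊆ wing w r) → Young p ⊆ Young r
wings-⊆ {p} {r} d≡ wings {i , j} y with i <? durfee p | j <? durfee p
... | yes i<d | yes j<d = durfee-square r (subst (i <_) d≡ i<d) (subst (j <_) d≡ j<d)
... | no  i≮d | no  j≮d = contradiction (young-downClosed p (≮⇒≥ i≮d) (≮⇒≥ j≮d) y) (durfee-corner p)
... | yes i<d | no  j≮d =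
  subst (λ l → (i , l) ∈ Young r) (trans (cong (j ∸ durfee p +_) (sym d≡)) (m∸n+n≡m (≮⇒≥ j≮d)))
    (proj₂ (to (wing-embed r upper) (wings upper (from (wing-embed p upper)
      (i<d , subst (λ l → (i , l) ∈ Young p) (sym (m∸n+n≡m (≮⇒≥ j≮d))) y)))))
... | no  i≮d | yes j<d =
  subst (λ k → (k , j) ∈ Young r) (trans (cong (i ∸ durfee p +_) (sym d≡)) (m∸n+n≡m (≮⇒≥ i≮d)))
    (proj₂ (to (wing-embed r lower) (wings lower (from (wing-embed p lower)
      (j<d , subst (λ k → (k , j) ∈ Young p) (sym (m∸n+n≡m (≮⇒≥ i≮d))) y)))))

wings-injective : ∀ {p r} → durfee p ≡ durfee r → (∀ w → wing w p ≐ wing w r) → p ≡ r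
wings-injective {p} {r} d≡ wings = young-injective
  ( wings-⊆ {p} {r} d≡ (λ w → proj₁ (wings w))
  , wings-⊆ {r} {p} (sym d≡) (λ w → proj₂ (wings w)))

module _ (d : ℕ) (W : Wing → Pred Cell 0ℓ) (W? : ∀ w → Decidable (W w))
         (down : ∀ w → DownClosed (W w)) (rows : ∀ w {c} → c ∈ W w → proj₁ c < d)
         {n : ℕ} (bound : ∀ w → (0 , n) ∉ W w) where

  private
    -- A cell (i , j) with d ≤ i and d ≤ j is excluded by the row bound on W upper.
    Assembled : Pred Cell 0ℓ
    Assembled (i , j) = (d ≤ j → (i , j ∸ d) ∈ W upper) × (d ≤ i → (j , i ∸ d) ∈ W lower)

    assembled? : Decidable Assembled
    assembled? (i , j) = ((d ≤? j) →-dec W? upper (i , j ∸ d)) ×-dec ((d ≤? i) →-dec W? lower (j , i ∸ d))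

    assembled-downClosed : DownClosed Assembled
    assembled-downClosed k≤i l≤j (u , v) =
      (λ d≤l → down upper k≤i (∸-monoˡ-≤ d l≤j) (u (≤-trans d≤l l≤j))) ,
      (λ d≤k → down lower l≤j (∸-monoˡ-≤ d k≤i) (v (≤-trans d≤k k≤i)))

    embed-assembled : ∀ w {c} → (proj₁ c < d × embed d w c ∈ Assembled) ⇔ c ∈ W w
    embed-assembled upper {i , j} = mk⇔
      (λ (i<d , u , _) → subst (λ l → (i , l) ∈ W upper) (m+n∸n≡m j d) (u (m≤n+m d j)))
      (λ c∈ → rows upper c∈ , (λ _ → subst (λ l → (i , l) ∈ W upper) (sym (m+n∸n≡m j d)) c∈) ,
                              (λ d≤i → contradiction (rows upper c∈) (≤⇒≯ d≤i)))
    embed-assembled lower {i , j} = mk⇔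
      (λ (i<d , _ , v) → subst (λ l → (i , l) ∈ W lower) (m+n∸n≡m j d) (v (m≤n+m d j)))
      (λ c∈ → rows lower c∈ , (λ d≤i → contradiction (rows lower c∈) (≤⇒≯ d≤i)) ,
                              (λ _ → subst (λ l → (i , l) ∈ W lower) (sym (m+n∸n≡m j d)) c∈))

  -- The assembled set is a Young diagram that contains the square of side `d` but not the corner
  -- `(d , d)`. Its Durfee size is therefore `d`, and cutting off the square returns the given
  -- wings.
  wings-surjective : ∃[ p ] durfee p ≡ d × (∀ w → wing w p ≐ W w)
  wings-surjective with young-surjective assembled? assembled-downClosed {n + d}
    -- The extreme cells `(n + d , 0)` and `(0 , n + d)` would put `(0 , n)` into a wing.
    (λ (_ , v) → bound lower (subst (λ l → (0 , l) ∈ W lower) (m+n∸n≡m n d) (v (m≤n+m d n))))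
    (λ (u , _) → bound upper (subst (λ l → (0 , l) ∈ W upper) (m+n∸n≡m n d) (u (m≤n+m d n))))
  ... | p , young , assembled with durfee-unique p {d}
    (λ i<d j<d → assembled ((λ d≤j → contradiction j<d (≤⇒≯ d≤j)) , (λ d≤i → contradiction i<d (≤⇒≯ d≤i))))
    -- The corner would put a cell with row index `d` into `W upper`.
    (λ y → <-irrefl refl (rows upper (proj₁ (young y) ≤-refl)))
  ... | refl = p , refl , λ w →
    (λ c∈ → let i< , y = to (wing-embed p w) c∈ in to (embed-assembled w) (i< , young y)) ,
    (λ c∈ → let i< , a = from (embed-assembled w) c∈ in from (wing-embed p w) (i< , assembled a))

-- Classes of partitions

-- The diagrams of `I` and `U`, written symmetrically in the two wings instead of by minima and
-- maxima.
Both Either : Partition → Pred Cell 0ℓ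
Both   p c = ∀ w → c ∈ wing w p
Either p c = ∃[ w ] c ∈ wing w p

both-I : ∀ p → Both p ≐ Diagram (durfee p) (I p)
both-I p = (λ b → proj₁ (b upper) , ⊓-pres-m< (proj₂ (b upper)) (proj₂ (b lower))) , λ where
  (i< , j<) upper → i< , m<n⊓o⇒m<n _ _ j<
  (i< , j<) lower → i< , m<n⊓o⇒m<o (α p _) _ j<

either-U : ∀ p → Either p ≐ Diagram (durfee p) (U p)
either-U p = (λ where
    (upper , i< , j<) → i< , m<n⇒m<n⊔o _ j<
    (lower , i< , j<) → i< , m<n⇒m<o⊔n _ j<) ,
  λ { {i , _} (i< , j<) → [ (λ e → upper , i< , subst (_ <_) e j<)
                          , (λ e → lower , i< , subst (_ <_) e j<) ]′ (⊔-sel (α p i) (β p i)) }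

skew⇔ : ∀ p {c} → c ∈ Skew p ⇔ (c ∈ Either p × c ∉ Both p)
skew⇔ p = mk⇔ (λ (u , ¬i) → proj₂ (either-U p) u , ¬i ∘ proj₁ (both-I p))
              (λ (e , ¬b) → proj₁ (either-U p) e , ¬b ∘ proj₂ (both-I p))

both : ∀ p w {c} → c ∈ wing w p → c ∈ wing (opposite w) p → c ∈ Both p
both p upper c∈ c∈′ upper = c∈
both p upper c∈ c∈′ lower = c∈′
both p lower c∈ c∈′ upper = c∈′
both p lower c∈ c∈′ lower = c∈

skew-exclusive : ∀ p w {c} → c ∈ Skew p → c ∈ wing w p → c ∉ wing (opposite w) p
skew-exclusive p w s c∈ c∈′ = proj₂ (to (skew⇔ p) s) (both p w c∈ c∈′)

skew-opposite : ∀ p w {c} → c ∈ Skew p → c ∉ wing w p → c ∈ wing (opposite w) p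
skew-opposite p w s c∉ with proj₁ (to (skew⇔ p) s)
... | v , c∈ with w ≟ʷ v
...   | inj₁ refl = contradiction c∈ c∉
...   | inj₂ refl = c∈

-- If `c′` is the smaller cell, down-closure of wing `w` suffices. If `c′` is the larger one and lay
-- in the opposite wing, then `c` would lie there too, but a skew cell lies in one wing only.
adjacent-wing : ∀ p w {c c′} → c ∈ Skew p → c′ ∈ Skew p → Adjacent c c′ → c ∈ wing w p → c′ ∈ wing w p
adjacent-wing p w {c} {c′} s s′ adj c∈ with comparable adj
  where
  comparable : ∀ {c c′} → Adjacent c c′ →
               (proj₁ c ≤ proj₁ c′ × proj₂ c ≤ proj₂ c′) ⊎ (proj₁ c′ ≤ proj₁ c × proj₂ c′ ≤ proj₂ c)
  comparable (inj₁ (refl , inj₁ refl)) = inj₁ (≤-refl , n≤1+n _)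
  comparable (inj₁ (refl , inj₂ refl)) = inj₂ (≤-refl , n≤1+n _)
  comparable (inj₂ (refl , inj₁ refl)) = inj₁ (n≤1+n _ , ≤-refl)
  comparable (inj₂ (refl , inj₂ refl)) = inj₂ (n≤1+n _ , ≤-refl)
... | inj₂ (k≤i , l≤j) = wing-downClosed w p k≤i l≤j c∈
... | inj₁ (i≤k , j≤l) with wing? w p c′
...   | yes c′∈ = c′∈
...   | no  c′∉ = contradiction (wing-downClosed (opposite w) p i≤k j≤l (skew-opposite p w s′ c′∉))
                                (skew-exclusive p w s c∈)

connected-wing : ∀ p w {c c′} → Connected Adjacent (Skew p) c c′ → c ∈ wing w p → c′ ∈ wing w p
connected-wing p w ε                      c∈ = c∈
connected-wing p w ((s , s′ , adj) ◅ path) c∈ = connected-wing p w path (adjacent-wing p w s s′ adj c∈)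

-- Equality of the data `d`, `I` and `U`. It is visibly an equivalence relation, and `class⇔similar`
-- transfers this to classes.
record Similar (p r : Partition) : Set where
  field
    durfee-≡ : durfee p ≡ durfee r
    both-≐   : Both p ≐ Both r
    either-≐ : Either p ≐ Either r

open Similar

similar-refl : ∀ p → Similar p p
similar-refl p = record { durfee-≡ = refl ; both-≐ = id , id ; either-≐ = id , id }

similar-sym : ∀ {p r} → Similar p r → Similar r p
similar-sym s = record { durfee-≡ = sym (durfee-≡ s) ; both-≐ = swap (both-≐ s) ; either-≐ = swap (either-≐ s) }

similar-trans : ∀ {p q r} → Similar p q → Similar q r → Similar p r
similar-trans s t = record
  { durfee-≡ = trans (durfee-≡ s) (durfee-≡ t)
  ; both-≐   = ≐-trans (both-≐ s) (both-≐ t)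
  ; either-≐ = ≐-trans (either-≐ s) (either-≐ t)
  }

similar-skew : ∀ {p r} → Similar p r → Skew p ⊆ Skew r
similar-skew {p} {r} s c∈ with to (skew⇔ p) c∈
... | e , ¬b = from (skew⇔ r) (proj₁ (either-≐ s) e , ¬b ∘ proj₂ (both-≐ s))

-- Diagonal blocks as connected components

block-skew : ∀ p b → Block p b ⊆ Skew p
block-skew p b c∈ = from (block-cover p) (b , c∈)

block-adjacent : ∀ p b {c c′} → c ∈ Block p b → c′ ∈ Skew p → Adjacent c c′ → c′ ∈ Block p b
block-adjacent p b {c} {c′} c∈ s′ adj = subst (λ b → c′ ∈ Block p b) (sym b≡b′) c′∈
  where
  b′ : Fin (κ p)
  b′ = proj₁ (to (block-cover p) s′)
  c′∈ : c′ ∈ Block p b′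
  c′∈ = proj₂ (to (block-cover p) s′)
  b≡b′ : b ≡ b′
  b≡b′ = from (block-connected p {b} {b′} {c} {c′} c∈ c′∈) ((block-skew p b c∈ , s′ , adj) ◅ ε)

block-unique : ∀ p {b b′ c} → c ∈ Block p b → c ∈ Block p b′ → b ≡ b′
block-unique p {b} {b′} {c} c∈ c∈′ = from (block-connected p {b} {b′} {c} {c} c∈ c∈′) ε

-- The block belongs to `p` and the wing to `r`. A path in the skew diagram of `p` is also one in
-- that of `r`, and such a path never changes wing.
block-wing : ∀ {p r} → Similar p r → ∀ w b {c c′} →
             c ∈ Block p b → c′ ∈ Block p b → c ∈ wing w r → c′ ∈ wing w r
block-wing {p} {r} s w b {c} {c′} c∈ c′∈ = connected-wing r w
  (Star.map (λ (x , y , e) → similar-skew s x , similar-skew s y , e)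
    (to (block-connected p {b} {b} {c} {c′} c∈ c′∈) refl))

representative : ∀ p → Fin (κ p) → Cell
representative p b = proj₁ (block-nonempty p b)

representative∈ : ∀ p b → representative p b ∈ Block p b
representative∈ p b = proj₂ (block-nonempty p b)

blockCells? : ∀ p s → Decidable (BlockCells p s)
blockCells? p s c = Fin.any? (λ b → (b Subset.∈? s) ×-dec
  DecMembership._∈?_ (Product.≡-dec _≟_ _≟_) c (lookup (blocks p) b))

blockCells⊆skew : ∀ p s → BlockCells p s ⊆ Skew p
blockCells⊆skew p s (b , _ , c∈) = block-skew p b c∈

blockCells-adjacent : ∀ p s {c c′} → c′ ∈ Skew p → Adjacent c c′ → c ∈ BlockCells p s → c′ ∈ BlockCells p s
blockCells-adjacent p s {c} {c′} s′ adj (b , b∈ , c∈) = b , b∈ , block-adjacent p b {c} {c′} c∈ s′ adj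

-- Flipping a union of blocks

either-downClosed : ∀ p → DownClosed (Either p)
either-downClosed p k≤i l≤j (w , c∈) = w , wing-downClosed w p k≤i l≤j c∈

both-downClosed : ∀ p → DownClosed (Both p)
both-downClosed p k≤i l≤j b w = wing-downClosed w p k≤i l≤j (b w)

both? : ∀ p → Decidable (Both p)
both? p c = map′ (λ { (u , l) upper → u ; (u , l) lower → l }) (λ b → b upper , b lower)
  (wing? upper p c ×-dec wing? lower p c)

-- The wings that `Flip` prescribes, for an arbitrary set `B` of moved cells.
flipped : Partition → Pred Cell 0ℓ → Wing → Pred Cell 0ℓ
flipped p B w = (wing w p ∖ B) ∪ (wing (opposite w) p ∩ B)

-- The hypotheses describe a union of connected components of the skew diagram without naming
-- blocks: `B` lies in it and is closed under adjacency there.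
module _ (p : Partition) {B : Pred Cell 0ℓ} (B? : Decidable B) (B⊆skew : B ⊆ Skew p)
         (B-adjacent : ∀ {c c′} → c′ ∈ Skew p → Adjacent c c′ → c ∈ B → c′ ∈ B) where

  private
    both∉B : ∀ {c} → c ∈ Both p → c ∉ B
    both∉B {c} b c∈ = proj₂ (to (skew⇔ p {c}) (B⊆skew c∈)) b

    flipped? : ∀ w → Decidable (flipped p B w)
    flipped? w c = (wing? w p c ×-dec ¬? (B? c)) ⊎-dec (wing? (opposite w) p c ×-dec B? c)

    flipped⊆either : ∀ w → flipped p B w ⊆ Either p
    flipped⊆either w (inj₁ (c∈ , _)) = w , c∈
    flipped⊆either w (inj₂ (c∈ , _)) = opposite w , c∈

    -- A cell outside the skew diagram is never moved, and adjacent cells of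
    -- the skew diagram are moved together.
    flipped-step : ∀ w {i j k l} → k ≤ i → l ≤ j → Adjacent (i , j) (k , l) →
                   (i , j) ∈ flipped p B w → (k , l) ∈ flipped p B w
    flipped-step w {i} {j} {k} {l} k≤i l≤j adj c∈ = go (both? p (k , l)) c∈
      where
      e : (i , j) ∈ Either p
      e = flipped⊆either w c∈
      go : Dec ((k , l) ∈ Both p) → (i , j) ∈ flipped p B w → (k , l) ∈ flipped p B w
      go (yes b) _ = inj₁ (b w , both∉B b)
      go (no ¬b) (inj₁ (c∈ , ∉B)) = inj₁ (wing-downClosed w p k≤i l≤j c∈ ,
        ∉B ∘ B-adjacent (from (skew⇔ p) (e , ¬b ∘ both-downClosed p k≤i l≤j)) (adjacent-sym {i , j} {k , l} adj))
      go (no ¬b) (inj₂ (c∈ , ∈B)) = inj₂ (wing-downClosed (opposite w) p k≤i l≤j c∈ ,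
        B-adjacent (from (skew⇔ p) (either-downClosed p k≤i l≤j e , ¬b)) adj ∈B)

    flipped-downClosed : ∀ w → DownClosed (flipped p B w)
    flipped-downClosed w = stepwise-downClosed
      (λ {i} → flipped-step w (n≤1+n i) ≤-refl (inj₂ (refl , inj₂ refl)))
      (λ {i} {j} → flipped-step w ≤-refl (n≤1+n j) (inj₁ (refl , inj₂ refl)))

  flipped-partition : ∃[ r ] durfee r ≡ durfee p × (∀ w → wing w r ≐ flipped p B w)
  flipped-partition = wings-surjective (durfee p) (flipped p B) flipped? flipped-downClosed
    (λ w c∈ → let v , c∈v = flipped⊆either w c∈ in wing-row v p c∈v)
    -- Row 0 of the union of the wings has exactly `U p 0` cells, so column `U p 0` is free in both
    -- flipped wings.
    {U p 0} (λ w c∈ → <-irrefl refl (proj₂ (proj₁ (either-U p) (flipped⊆either w c∈))))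

  -- A moved cell lies in one wing before and in one wing after. Whether a cell is in `B` does not
  -- depend on the wing, so the mixed cases of `both-back` are contradictory.
  flipped-similar : ∀ {r} → durfee r ≡ durfee p → (∀ w → wing w r ≐ flipped p B w) → Similar p r
  flipped-similar {r} d≡ wings = record
    { durfee-≡ = sym d≡
    ; both-≐ = (λ b w → proj₂ (wings w) (inj₁ (b w , both∉B b)))
             , (λ b → both-back (proj₁ (wings upper) (b upper)) (proj₁ (wings lower) (b lower)))
    ; either-≐ = (λ {c} (w , c∈) → either c w c∈ (B? c))
               , (λ (w , c∈) → flipped⊆either w (proj₁ (wings w) c∈))
    }
    where
    both-back : ∀ {c} → c ∈ flipped p B upper → c ∈ flipped p B lower → c ∈ Both p
    both-back (inj₁ (u , _))  (inj₁ (l , _))  = both p upper u l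
    both-back (inj₁ (_ , ∉B)) (inj₂ (_ , ∈B)) = contradiction ∈B ∉B
    both-back (inj₂ (_ , ∈B)) (inj₁ (_ , ∉B)) = contradiction ∈B ∉B
    both-back (inj₂ (l , _))  (inj₂ (u , _))  = both p upper u l
    either : ∀ c w → c ∈ wing w p → Dec (c ∈ B) → c ∈ Either r
    either c w c∈ (no  ∉B) = w , proj₂ (wings w) (inj₁ (c∈ , ∉B))
    either c w c∈ (yes ∈B) = opposite w , proj₂ (wings (opposite w))
      (inj₂ (subst (λ v → c ∈ wing v p) (sym (opposite-involutive w)) c∈ , ∈B))

flip : ∀ p s → ∃! _≡_ (Flip p s)
flip p s = r , record { same-durfee = d≡ ; flip-wing = wings } , λ f →
  wings-injective (trans d≡ (sym (Flip.same-durfee f))) (λ w → ≐-trans (wings w) (swap (Flip.flip-wing f w)))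
  where
  F : ∃[ r ] durfee r ≡ durfee p × (∀ w → wing w r ≐ flipped p (BlockCells p s) w)
  F = flipped-partition p (blockCells? p s)
    (λ {c} → blockCells⊆skew p s {c}) (λ {c} {c′} → blockCells-adjacent p s {c} {c′})
  r = proj₁ F
  d≡ = proj₁ (proj₂ F)
  wings = proj₂ (proj₂ F)

flip-similar : ∀ {p s r} → Flip p s r → Similar p r
flip-similar {p} {s} f = flipped-similar p (blockCells? p s)
  (λ {c} → blockCells⊆skew p s {c}) (λ {c} {c′} → blockCells-adjacent p s {c} {c′})
  (Flip.same-durfee f) (Flip.flip-wing f)

flip-inside : ∀ {p s r} → Flip p s r → ∀ w b {c} →
              b ∈ˢ s → c ∈ Block p b → c ∈ wing (opposite w) p → c ∈ wing w r
flip-inside f w b b∈ c∈ c∈w = proj₂ (Flip.flip-wing f w) (inj₂ (c∈w , b , b∈ , c∈))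

flip-outside : ∀ {p s r} → Flip p s r → ∀ w b {c} →
               b ∉ˢ s → c ∈ Block p b → c ∈ wing w p → c ∈ wing w r
flip-outside {p} {s} f w b {c} b∉ c∈ c∈w = proj₂ (Flip.flip-wing f w)
  (inj₁ (c∈w , λ (b′ , b′∈ , c∈′) → b∉ (subst (_∈ˢ s) (block-unique p {b′} {b} {c} c∈′ c∈) b′∈)))

-- A block flipped by `s` but not by `t` would place its representative in both wings of `r`,
-- although that cell belongs to the skew diagram of `r`.
flip-⊆ : ∀ {p s t r} → Flip p s r → Flip p t r → ∀ {b} → b ∈ˢ s → b ∈ˢ t
flip-⊆ {p} {s} {t} {r} f g {b} b∈s = decidable-stable (b Subset.∈? t) (λ b∉t →
  skew-exclusive r w {c} (similar-skew (flip-similar f) (block-skew p b c∈))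
    (flip-outside g w b {c} b∉t c∈ c∈w)
    (flip-inside f (opposite w) b {c} b∈s c∈ (subst (λ v → c ∈ wing v p) (sym (opposite-involutive w)) c∈w)))
  where
  c : Cell
  c = representative p b
  c∈ : c ∈ Block p b
  c∈ = representative∈ p b
  side : c ∈ Either p
  side = proj₁ (to (skew⇔ p {c}) (block-skew p b {c} c∈))
  w : Wing
  w = proj₁ side
  c∈w : c ∈ wing w p
  c∈w = proj₂ side

flip-injective : ∀ {p s t r} → Flip p s r → Flip p t r → s ≡ t
flip-injective f g = Subset.⊆-antisym (flip-⊆ f g) (flip-⊆ g f)

-- Prescribing a wing for every block

placed-⊆ : ∀ {p w q r} → Similar p q → Similar p r → Placed p w q → Placed p w r → ∀ v → wing v q ⊆ wing v r
placed-⊆ {p} {w} {q} {r} s t pq pr v {c} c∈ = go (both? p c)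
  where
  in-block : ∀ b → c ∈ Block p b → w b ≡ v ⊎ opposite (w b) ≡ v → c ∈ wing v r
  in-block b c∈b (inj₁ e) = subst (λ u → c ∈ wing u r) e (proj₁ (pr b {c} c∈b))
  in-block b c∈b (inj₂ e) = contradiction (subst (λ u → c ∈ wing u q) (sym e) c∈) (proj₂ (pq b {c} c∈b))
  -- A cell common to the wings of `p` stays common; every other cell of a wing lies in a block,
  -- whose wing is fixed by `w`.
  go : Dec (c ∈ Both p) → c ∈ wing v r
  go (yes b) = proj₁ (both-≐ t) b v
  go (no ¬b) = in-block b (proj₂ B) (w b ≟ʷ v)
    where
    B : ∃[ b ] c ∈ Block p b
    B = to (block-cover p) (from (skew⇔ p) (proj₂ (either-≐ s) (v , c∈) , ¬b))
    b = proj₁ B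

placed-unique : ∀ {p w q r} → Similar p q → Similar p r → Placed p w q → Placed p w r → q ≡ r
placed-unique {p} {w} {q} {r} s t pq pr = wings-injective (trans (sym (durfee-≡ s)) (durfee-≡ t))
  (λ v → placed-⊆ {p} {w} {q} {r} s t pq pr v , placed-⊆ {p} {w} {r} {q} t s pr pq v)

comprehension : ∀ {n} {P : Pred (Fin n) 0ℓ} → Decidable P → ∃[ s ] (∀ b → b ∈ˢ s ⇔ P b)
comprehension {zero}  P? = [] , λ ()
comprehension {suc n} P? with P? zero | comprehension (P? ∘ suc)
... | yes P0 | s , s⇔ = inside ∷ s , λ where
  zero    → mk⇔ (λ _ → P0) (λ _ → here)
  (suc b) → mk⇔ (to (s⇔ b) ∘ Subset.drop-there) (there ∘ from (s⇔ b))
... | no ¬P0 | s , s⇔ = outside ∷ s , λ where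
  zero    → mk⇔ (λ ()) (λ P0 → contradiction P0 ¬P0)
  (suc b) → mk⇔ (to (s⇔ b) ∘ Subset.drop-there) (there ∘ from (s⇔ b))

-- One cell decides for its whole block: the others follow it by connectedness, and skew cells avoid
-- the opposite wing.
block-placed : ∀ {p r} → Similar p r → ∀ w b {c} → c ∈ Block p b → c ∈ wing w r →
               Block p b ⊆ wing w r ∖ wing (opposite w) r
block-placed {p} {r} s w b {c} c∈ c∈w {c′} c′∈ =
  c′∈w , skew-exclusive r w (similar-skew s (block-skew p b {c′} c′∈)) c′∈w
  where
  c′∈w : c′ ∈ wing w r
  c′∈w = block-wing s w b {c} {c′} c∈ c′∈ c∈w

-- Flip exactly those blocks whose representative is not yet in the prescribed wing.
choose : ∀ p w → ∃[ r ] r ∈ Class p × r ∈ Placed p w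
choose p w = r , (s , f) , λ b {c} → block-placed (flip-similar f) (w b) b {representative p b} (representative∈ p b)
  (placed b (wing? (w b) p (representative p b))) {c}
  where
  S : ∃[ s ] (∀ b → b ∈ˢ s ⇔ representative p b ∉ wing (w b) p)
  S = comprehension (λ b → ¬? (wing? (w b) p (representative p b)))
  s : Subset (κ p)
  s = proj₁ S
  s⇔ : ∀ b → b ∈ˢ s ⇔ representative p b ∉ wing (w b) p
  s⇔ = proj₂ S
  r : Partition
  r = proj₁ (flip p s)
  f : Flip p s r
  f = proj₁ (proj₂ (flip p s))
  placed : ∀ b → Dec (representative p b ∈ wing (w b) p) → representative p b ∈ wing (w b) r
  placed b (yes c∈w) = flip-outside f (w b) b {representative p b} (λ b∈ → to (s⇔ b) b∈ c∈w) (representative∈ p b) c∈w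
  placed b (no  c∉w) = flip-inside f (w b) b {representative p b} (from (s⇔ b) c∉w) (representative∈ p b)
    (skew-opposite p (w b) (block-skew p b {representative p b} (representative∈ p b)) c∉w)

-- Read off from `r` the wing of each block. The member of the class with this placement must be
-- `r`, because placements determine similar partitions.
similar⇒class : ∀ {p r} → Similar p r → r ∈ Class p
similar⇒class {p} {r} s = subst (_∈ Class p) q≡r q∈
  where
  side : ∀ b → representative p b ∈ Either r
  side b = proj₁ (to (skew⇔ r) (similar-skew s (block-skew p b {representative p b} (representative∈ p b))))
  w : Fin (κ p) → Wing
  w b = proj₁ (side b)
  q : Partition
  q = proj₁ (choose p w)
  q∈ : q ∈ Class p
  q∈ = proj₁ (proj₂ (choose p w))
  q≡r : q ≡ r
  q≡r = placed-unique {p} {w} (flip-similar (proj₂ q∈)) s (proj₂ (proj₂ (choose p w)))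
    (λ b {c} → block-placed s (w b) b {representative p b} (representative∈ p b) (proj₂ (side b)) {c})

class⇔similar : ∀ {p r} → r ∈ Class p ⇔ Similar p r
class⇔similar = mk⇔ (λ (_ , f) → flip-similar f) similar⇒class

class-placed : ∀ p w → ∃! _≡_ (Class p ∩ Placed p w)
class-placed p w = proj₁ chosen , proj₂ chosen , λ {q} (q∈ , placed) →
  placed-unique {p} {w} (to class⇔similar (proj₁ (proj₂ chosen))) (to class⇔similar q∈) (proj₂ (proj₂ chosen)) placed
  where
  chosen : ∃[ r ] r ∈ Class p × r ∈ Placed p w
  chosen = choose p w

boolean : ∀ p → Boolean p
boolean p = record { independent = flip p ; choice = class-placed p }

class-refl : ∀ p → p ∈ Class p
class-refl p = from class⇔similar (similar-refl p)

class-sym : ∀ {p r} → r ∈ Class p → p ∈ Class r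
class-sym r∈ = from class⇔similar (similar-sym (to class⇔similar r∈))

class-trans : ∀ {p q r} → q ∈ Class p → r ∈ Class q → r ∈ Class p
class-trans q∈ r∈ = from class⇔similar (similar-trans (to class⇔similar q∈) (to class⇔similar r∈))

-- Sizes

⊓+⊔ : ∀ m n → m ⊓ n + (m ⊔ n) ≡ m + n
⊓+⊔ m n with ≤-total m n
... | inj₁ m≤n = cong₂ _+_ (m≤n⇒m⊓n≡m m≤n) (m≤n⇒m⊔n≡n m≤n)
... | inj₂ n≤m = trans (cong₂ _+_ (m≥n⇒m⊓n≡n n≤m) (m≥n⇒m⊔n≡m n≤m)) (+-comm n m)

sum-applyUpTo-last : ∀ f n → sum (applyUpTo f (suc n)) ≡ sum (applyUpTo f n) + f n
sum-applyUpTo-last f zero    = +-identityʳ (f 0)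
sum-applyUpTo-last f (suc n) = trans (cong (f 0 +_) (sum-applyUpTo-last (f ∘ suc) n)) (sym (+-assoc (f 0) _ _))

sum-applyUpTo-+ : ∀ f g n → sum (applyUpTo (λ i → f i + g i) n) ≡ sum (applyUpTo f n) + sum (applyUpTo g n)
sum-applyUpTo-+ f g zero    = refl
sum-applyUpTo-+ f g (suc n) = trans
  (cong (f 0 + g 0 +_) (sum-applyUpTo-+ (f ∘ suc) (g ∘ suc) n)) (+-interchange (f 0) (g 0) _ _)

sum-applyUpTo-cong : ∀ {f g} n → (∀ {i} → i < n → f i ≡ g i) → sum (applyUpTo f n) ≡ sum (applyUpTo g n)
sum-applyUpTo-cong zero    eq = refl
sum-applyUpTo-cong (suc n) eq = cong₂ _+_ (eq (s≤s z≤n)) (sum-applyUpTo-cong n (eq ∘ s≤s))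

-- Raising the cap from `d` to `suc d` gains one cell in each row longer than `d`.
sum-⊓-suc : ∀ d xs → sum (map (_⊓ suc d) xs) ≡ sum (map (_⊓ d) xs) + length (filter (d <?_) xs)
sum-⊓-suc d []       = refl
sum-⊓-suc d (x ∷ xs) with d <? x
... | yes d<x rewrite List.filter-accept (d <?_) {x} {xs} d<x | m≥n⇒m⊓n≡n d<x | m≥n⇒m⊓n≡n (<⇒≤ d<x) =
  trans (cong (suc d +_) (sum-⊓-suc d xs)) (trans (cong suc (sym (+-assoc d _ _))) (sym (+-suc _ _)))
... | no  d≮x rewrite List.filter-reject (d <?_) {x} {xs} d≮x | m≤n⇒m⊓n≡m (≮⇒≥ d≮x)
                    | m≤n⇒m⊓n≡m (m≤n⇒m≤1+n (≮⇒≥ d≮x)) =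
  trans (cong (x +_) (sum-⊓-suc d xs)) (sym (+-assoc x _ _))

-- Both sides count the cells in the first `d` columns, once by columns and once by rows.
sum-columns : ∀ xs d → sum (applyUpTo (λ j → length (filter (j <?_) xs)) d) ≡ sum (map (_⊓ d) xs)
sum-columns []       zero    = refl
sum-columns (x ∷ xs) zero    = trans (sum-columns xs zero) (cong (_+ sum (map (_⊓ 0) xs)) (sym (⊓-zeroʳ x)))
sum-columns xs       (suc d) = trans (sum-applyUpTo-last _ d)
  (trans (cong (_+ length (filter (d <?_) xs)) (sum-columns xs d)) (sym (sum-⊓-suc d xs)))

-- The first `k` rows and the first `d` columns cover the diagram; the cells counted twice form the
-- `k` by `d` rectangle.
sum-rows : ∀ xs d k → (∀ {i} → i < k → d ≤ nth xs i) → (∀ {i} → k ≤ i → nth xs i ≤ d) →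
           sum xs + k * d ≡ sum (applyUpTo (nth xs) k) + sum (map (_⊓ d) xs)
sum-rows []       d zero    long short = refl
sum-rows []       d (suc k) long short with long {0} (s≤s z≤n)
-- An empty list has only rows of length 0, so `d` is 0.
... | z≤n = sum-rows [] 0 k (λ _ → z≤n) (λ _ → z≤n)
sum-rows (x ∷ xs) d zero    long short = trans (+-assoc x _ _)
  (cong₂ _+_ (sym (m≤n⇒m⊓n≡m (short {0} z≤n))) (sum-rows xs d zero (λ ()) (λ {i} _ → short {suc i} z≤n)))
sum-rows (x ∷ xs) d (suc k) long short = begin
  x + sum xs + (d + k * d)                ≡⟨ +-assoc x _ _ ⟩
  x + (sum xs + (d + k * d))              ≡⟨ cong (x +_) (x∙yz≈y∙xz (sum xs) d _) ⟩
  x + (d + (sum xs + k * d))              ≡⟨ cong (λ z → x + (d + z)) (sum-rows xs d k (long ∘ s≤s) (short ∘ s≤s)) ⟩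
  x + (d + (R + C))                       ≡⟨ cong (x +_) (x∙yz≈y∙xz d R C) ⟩
  x + (R + (d + C))                       ≡⟨ +-assoc x _ _ ⟨
  x + R + (d + C)                         ≡⟨ cong (λ z → x + R + (z + C)) (m≥n⇒m⊓n≡n (long {0} (s≤s z≤n))) ⟨
  x + R + (x ⊓ d + C)                     ∎
  where
  open ≡-Reasoning
  R = sum (applyUpTo (nth xs) k)
  C = sum (map (_⊓ d) xs)

durfee≤row : ∀ p {i} → i < durfee p → durfee p ≤ row p i
durfee≤row p i<d = <-extensional (durfee-square p i<d)

durfee≤col : ∀ p {i} → i < durfee p → durfee p ≤ col p i
durfee≤col p {i} i<d = <-extensional (λ {j} j<d → to (row-col p j i) (durfee-square p j<d i<d))

-- The rows and columns through the Durfee square cover the diagram and meet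
-- exactly in the square.
size-durfee : ∀ p → size p + durfee p * durfee p ≡ sum (applyUpTo (λ i → row p i + col p i) (durfee p))
size-durfee p = trans
  (sum-rows (parts p) d d (durfee≤row p)
    (λ {i} d≤i → ≮⇒≥ (λ d<row → durfee-corner p (young-downClosed p d≤i ≤-refl d<row))))
  (trans (cong (sum (applyUpTo (row p) d) +_) (sym (sum-columns (parts p) d)))
    (sym (sum-applyUpTo-+ (row p) (col p) d)))
  where d = durfee p

-- Expresses the hook-wise count by `I` and `U`, which are constant on a class, since minimum and
-- maximum add up to `α p i + β p i`.
row+col : ∀ p {i} → i < durfee p → row p i + col p i ≡ I p i + U p i + (durfee p + durfee p)
row+col p {i} i<d = begin
  row p i + col p i              ≡⟨ cong₂ _+_ (m∸n+n≡m (durfee≤row p i<d)) (m∸n+n≡m (durfee≤col p i<d)) ⟨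
  (α p i + d) + (β p i + d)      ≡⟨ +-interchange (α p i) d (β p i) d ⟩
  (α p i + β p i) + (d + d)      ≡⟨ cong (_+ (d + d)) (⊓+⊔ (α p i) (β p i)) ⟨
  I p i + U p i + (d + d)        ∎
  where
  open ≡-Reasoning
  d = durfee p

diagram-≤ : ∀ {d f g} → Diagram d f ⊆ Diagram d g → ∀ {i} → i < d → f i ≤ g i
diagram-≤ f⊆g i<d = <-extensional (λ j<f → proj₂ (f⊆g (i<d , j<f)))

similar-I+U : ∀ {p r} → Similar p r → ∀ {i} → i < durfee p → I p i + U p i ≡ I r i + U r i
similar-I+U {p} {r} s {i} i<d = ≤-antisym
  (one-way (durfee-≡ s) (proj₁ (both-≐ s)) (proj₁ (either-≐ s)) i<d)
  (one-way (sym (durfee-≡ s)) (proj₂ (both-≐ s)) (proj₂ (either-≐ s)) (subst (i <_) (durfee-≡ s) i<d))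
  where
  one-way : ∀ {p r} → durfee p ≡ durfee r → Both p ⊆ Both r → Either p ⊆ Either r →
            ∀ {i} → i < durfee p → I p i + U p i ≤ I r i + U r i
  one-way {p} {r} d≡ b e {i} i<d = +-mono-≤
    (<-extensional (λ {j} j< → proj₂ (proj₁ (both-I r) (b {i , j} (proj₂ (both-I p) (i<d , j<))))))
    (<-extensional (λ {j} j< → proj₂ (proj₁ (either-U r) (e {i , j} (proj₂ (either-U p) (i<d , j<))))))

-- By `size-durfee` and `row+col` the size depends only on `d` and the sums `I + U`.
similar-size : ∀ {p r} → Similar p r → size p ≡ size r
similar-size {p} {r} s = +-cancelʳ-≡ (durfee p * durfee p) (size p) (size r) (begin
  size p + d * d                               ≡⟨ size-durfee p ⟩
  sum (applyUpTo (λ i → row p i + col p i) d)  ≡⟨ sum-applyUpTo-cong d same ⟩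
  rows+cols d                                  ≡⟨ cong rows+cols (durfee-≡ s) ⟩
  rows+cols (durfee r)                         ≡⟨ size-durfee r ⟨
  size r + durfee r * durfee r                 ≡⟨ cong (λ d → size r + d * d) (durfee-≡ s) ⟨
  size r + d * d                               ∎)
  where
  open ≡-Reasoning
  d = durfee p
  rows+cols : ℕ → ℕ
  rows+cols n = sum (applyUpTo (λ i → row r i + col r i) n)
  same : ∀ {i} → i < d → row p i + col p i ≡ row r i + col r i
  same i<d = trans (row+col p i<d) (trans
    (cong₂ _+_ (similar-I+U s i<d) (cong₂ _+_ (durfee-≡ s) (durfee-≡ s)))
    (sym (row+col r (subst (_ <_) (durfee-≡ s) i<d))))

class-size : ∀ p {r} → r ∈ Class p → size r ≡ size p
class-size p r∈ = sym (similar-size (to class⇔similar r∈))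

-- Partitions with nonnegative ranks

lower⊆upper : ∀ {p} → p ∈ 𝒫⁺ → wing lower p ⊆ wing upper p
lower⊆upper {p} pos (i<d , j<β) =
  i<d , <-≤-trans j<β (∸-monoˡ-≤ (durfee p) (ℤ.drop‿+≤+ (ℤ.0≤i-j⇒j≤i (pos i<d))))

𝒫⁺-intro : ∀ {p} → wing lower p ⊆ wing upper p → p ∈ 𝒫⁺
𝒫⁺-intro {p} l⊆u {i} i<d = ℤ.i≤j⇒0≤j-i (ℤ.+≤+ (∸-cancelʳ-≤′ (durfee≤row p i<d) (diagram-≤ l⊆u i<d)))
  where
  -- This uses `m ≤ d + (m ∸ d)`, which survives truncation, and `d + (n ∸ d) ≡ n`.
  ∸-cancelʳ-≤′ : ∀ {m n d} → d ≤ n → m ∸ d ≤ n ∸ d → m ≤ n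
  ∸-cancelʳ-≤′ {m} {n} {d} d≤n le = subst (m ≤_) (m+[n∸m]≡n d≤n) (≤-trans (m≤n+m∸n m d) (+-monoʳ-≤ d le))

-- Nonnegative ranks mean that the lower wing is contained in the upper one, so no skew cell lies in
-- the lower wing. The unique member in `𝒫⁺` thus becomes an instance of `class-placed`.
𝒫⁺⇔placed : ∀ {p r} → Similar p r → r ∈ 𝒫⁺ ⇔ r ∈ Placed p (λ _ → upper)
𝒫⁺⇔placed {p} {r} s = mk⇔
  (λ pos b {c} c∈ → all-upper (λ {i} → pos {i}) (similar-skew s (block-skew p b {c} c∈)))
  (λ placed {i} → 𝒫⁺-intro {r} (λ {c} c∈ → below (λ b {c} → placed b {c}) c∈ (both? p c)) {i})
  where
  all-upper : r ∈ 𝒫⁺ → Skew r ⊆ wing upper r ∖ wing lower r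
  all-upper pos {c} c∈ = c∈u , skew-exclusive r upper c∈ c∈u
    where
    c∈u : c ∈ wing upper r
    c∈u = decidable-stable (wing? upper r c)
      (λ c∉ → c∉ (lower⊆upper {r} (λ {i} → pos {i}) (skew-opposite r upper c∈ c∉)))
  below : r ∈ Placed p (λ _ → upper) → ∀ {c} → c ∈ wing lower r → Dec (c ∈ Both p) → c ∈ wing upper r
  below placed     c∈ (yes b) = proj₁ (both-≐ s) b upper
  below placed {c} c∈ (no ¬b) = proj₁ (placed (proj₁ B) {c} (proj₂ B))
    where
    B : ∃[ b ] c ∈ Block p b
    B = to (block-cover p) (from (skew⇔ p) (proj₂ (either-≐ s) (lower , c∈) , ¬b))

class-𝒫⁺ : ∀ p → ∃! _≡_ (Class p ∩ 𝒫⁺)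
class-𝒫⁺ p = r ,
  (r∈ , λ {i} → from (𝒫⁺⇔placed (to class⇔similar r∈)) (λ b {c} → placed b {c}) {i}) ,
  λ {q} (q∈ , pos) → unique (q∈ , to (𝒫⁺⇔placed (to class⇔similar q∈)) (λ {i} → pos {i}))
  where
  chosen : ∃! _≡_ (Class p ∩ Placed p (λ _ → upper))
  chosen = class-placed p (λ _ → upper)
  r = proj₁ chosen
  r∈ = proj₁ (proj₁ (proj₂ chosen))
  placed = proj₂ (proj₁ (proj₂ chosen))
  unique = proj₂ (proj₂ chosen)

-- Cardinality of a class

subsets : ∀ n → List (Subset n)
subsets zero    = [] ∷ []
subsets (suc n) = map (inside ∷_) (subsets n) ++ map (outside ∷_) (subsets n)

length-subsets : ∀ n → length (subsets n) ≡ 2 ^ n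
length-subsets zero    = refl
length-subsets (suc n) = trans (List.length-++ (map (inside ∷_) (subsets n)))
  (cong₂ _+_ (trans (List.length-map _ (subsets n)) (length-subsets n))
    (trans (List.length-map _ (subsets n)) (trans (length-subsets n) (sym (+-identityʳ _)))))

∈-subsets : ∀ {n} (s : Subset n) → s ∈ˡ subsets n
∈-subsets []            = here refl
∈-subsets (inside ∷ s)  = ∈-++⁺ˡ (∈-map⁺ (inside ∷_) (∈-subsets s))
∈-subsets (outside ∷ s) = ∈-++⁺ʳ _ (∈-map⁺ (outside ∷_) (∈-subsets s))

subsets-unique : ∀ n → Unique (subsets n)
subsets-unique zero    = [] ∷ []
subsets-unique (suc n) = Unique.++⁺
  (Unique.map⁺ ∷-injectiveʳ (subsets-unique n)) (Unique.map⁺ ∷-injectiveʳ (subsets-unique n))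
  (λ (s∈ , s∈′) → case ∈-map⁻ (inside ∷_) s∈ , ∈-map⁻ (outside ∷_) s∈′ of λ { ((_ , _ , refl) , (_ , _ , ())) })

subset-images : ∀ {A : Set} {n} {R : Subset n → Pred A 0ℓ} → (∀ s → ∃! _≡_ (R s)) →
                (∀ {s t x} → R s x → R t x → s ≡ t) → HasCardinality (λ x → ∃[ s ] R s x) (2 ^ n)
subset-images {A} {n} {R} F injective = map image (subsets n) ,
  Unique.map⁺ (λ {s} {t} e → injective (related s) (subst (R t) (sym e) (related t))) (subsets-unique n) ,
  trans (List.length-map image (subsets n)) (length-subsets n) ,
  λ x → mk⇔
    (λ x∈ → let s , _ , x≡ = ∈-map⁻ image x∈ in s , subst (R s) (sym x≡) (related s))
    (λ (s , Rsx) → subst (_∈ˡ map image (subsets n)) (proj₂ (proj₂ (F s)) Rsx) (∈-map⁺ image (∈-subsets s)))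
  where
  image : Subset n → A
  image s = proj₁ (F s)
  related : ∀ s → R s (image s)
  related s = proj₁ (proj₂ (F s))

class-cardinality : ∀ p → HasCardinality (Class p) (2 ^ κ p)
class-cardinality p = subset-images {R = Flip p} (flip p) flip-injective

-- Searching the enumerating list decides membership; `class-dichotomy` obtains its case distinction
-- from this.
cardinality⇒decidable : ∀ {A : Set} {P : Pred A 0ℓ} {n} → DecidableEquality A → HasCardinality P n → Decidable P
cardinality⇒decidable _≟_ (xs , _ , _ , xs⇔P) x = map′ (to (xs⇔P x)) (from (xs⇔P x)) (DecMembership._∈?_ _≟_ x xs)

class? : ∀ p → Decidable (Class p)
class? p = cardinality⇒decidable _≟ᴾ_ (class-cardinality p)

class-≐ : ∀ {p r} → r ∈ Class p → Class p ≐ Class r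
class-≐ {p} {r} r∈ = (λ {q} q∈ → class-trans {r} {p} {q} (class-sym {p} {r} r∈) q∈)
                   , (λ {q} q∈ → class-trans {p} {r} {q} r∈ q∈)

class-⊥ : ∀ {p r} → r ∉ Class p → Class p ⊥ Class r
class-⊥ {p} {r} r∉ {q} (q∈p , q∈r) = r∉ (class-trans {p} {q} {r} q∈p (class-sym {r} {q} q∈r))

class-dichotomy : ∀ p r → (Class p ≐ Class r) ⊎ (Class p ⊥ Class r)
class-dichotomy p r = Sum.map (class-≐ {p} {r}) (class-⊥ {p} {r}) (toSum (class? p r))

-- Counting the partitions of n by classes

unique-length : ∀ {A : Set} {xs ys : List A} → Unique xs → Unique ys →
                (∀ {x} → x ∈ˡ xs ⇔ x ∈ˡ ys) → length xs ≡ length ys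
unique-length xs! ys! xs⇔ys = ↭-length (∼bag⇒↭ (unique∧set⇒bag xs! ys! xs⇔ys))

length-concatMap : ∀ {A B : Set} (f : A → List B) xs → length (concatMap f xs) ≡ sum (map (length ∘ f) xs)
length-concatMap f []       = refl
length-concatMap f (x ∷ xs) = trans (List.length-++ (f x)) (cong (length (f x) +_) (length-concatMap f xs))

concatMap-unique : ∀ {A B : Set} (f : A → List B) {xs} → Unique xs → (∀ x → Unique (f x)) →
                   (∀ {x x′ y} → x ∈ˡ xs → x′ ∈ˡ xs → y ∈ˡ f x → y ∈ˡ f x′ → x ≡ x′) → Unique (concatMap f xs)
concatMap-unique f {[]}     []          f! inj = []
concatMap-unique f {x ∷ xs} (x∉ ∷ xs!) f! inj = Unique.++⁺ (f! x)
  (concatMap-unique f xs! f! (λ x∈ x′∈ → inj (there x∈) (there x′∈)))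
  (λ (y∈ , y∈′) → let x′ , x′∈ , y∈f = find (∈-concatMap⁻ f {xs = xs} y∈′)
                   in All.lookup x∉ x′∈ (inj (here refl) (there x′∈) y∈ y∈f))

-- The sets `P x` partition the members of `ys`, so their concatenated enumerations form a list
-- without repetitions and with the same members as `ys`.
sum-cardinalities : ∀ {A B : Set} {P : A → Pred B 0ℓ} {N : A → ℕ} → (∀ x → HasCardinality (P x) (N x)) →
  ∀ {xs ys} → Unique xs → Unique ys →
  (∀ {x x′ y} → x ∈ˡ xs → x′ ∈ˡ xs → y ∈ P x → y ∈ P x′ → x ≡ x′) →
  (∀ {y} → y ∈ˡ ys ⇔ (∃[ x ] x ∈ˡ xs × y ∈ P x)) → sum (map N xs) ≡ length ys
sum-cardinalities {A} {B} {P} {N} C {xs} {ys} xs! ys! inj cover = begin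
  sum (map N xs)                   ≡⟨ cong sum (List.map-cong (λ x → sym (proj₁ (proj₂ (proj₂ (C x))))) xs) ⟩
  sum (map (length ∘ members) xs)  ≡⟨ length-concatMap members xs ⟨
  length (concatMap members xs)    ≡⟨ unique-length concat! ys! (mk⇔ covered⁻ covered⁺) ⟩
  length ys                        ∎
  where
  open ≡-Reasoning
  members : A → List B
  members x = proj₁ (C x)
  members⇔ : ∀ x {y} → y ∈ˡ members x ⇔ y ∈ P x
  members⇔ x = proj₂ (proj₂ (proj₂ (C x))) _
  concat! : Unique (concatMap members xs)
  concat! = concatMap-unique members xs! (λ x → proj₁ (proj₂ (C x)))
    (λ x∈ x′∈ y∈ y∈′ → inj x∈ x′∈ (to (members⇔ _) y∈) (to (members⇔ _) y∈′))
  covered⁻ : ∀ {y} → y ∈ˡ concatMap members xs → y ∈ˡ ys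
  covered⁻ y∈ with find (∈-concatMap⁻ members {xs = xs} y∈)
  ... | x , x∈ , y∈x = from cover (x , x∈ , to (members⇔ x) y∈x)
  covered⁺ : ∀ {y} → y ∈ˡ ys → y ∈ˡ concatMap members xs
  covered⁺ y∈ with to cover y∈
  ... | x , x∈ , y∈x = ∈-concatMap⁺ members (lose x∈ (from (members⇔ x) y∈x))

𝒫⁺-class-unique : ∀ {p r q} → p ∈ 𝒫⁺ → r ∈ 𝒫⁺ → q ∈ Class p → q ∈ Class r → p ≡ r
𝒫⁺-class-unique {p} {r} {q} p⁺ r⁺ q∈p q∈r = trans
  (sym (unique (class-sym {p} {q} q∈p , λ {i} → p⁺ {i}))) (unique (class-sym {r} {q} q∈r , λ {i} → r⁺ {i}))
  where
  unique : ∀ {x} → x ∈ Class q ∩ 𝒫⁺ → proj₁ (class-𝒫⁺ q) ≡ x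
  unique = proj₂ (proj₂ (class-𝒫⁺ q))

-- By `closed` the list is a union of whole classes, and each class is counted at its only member in
-- `𝒫⁺`.
sum-classes : ∀ {ps} → Unique ps → (∀ {p q} → p ∈ˡ ps → q ∈ Class p → q ∈ˡ ps) →
              sum (map (λ p → 2 ^ κ p) (filter 𝒫⁺? ps)) ≡ length ps
sum-classes {ps} ps! closed = sum-cardinalities class-cardinality (Unique.filter⁺ 𝒫⁺? ps!) ps!
  (λ {p} {r} {q} p∈ r∈ → 𝒫⁺-class-unique {p} {r} {q}
    (λ {i} → proj₂ (positive-rank p∈) {i}) (λ {i} → proj₂ (positive-rank r∈) {i}))
  (λ {q} → mk⇔ cover (λ (p , p∈ , q∈) → closed {p} {q} (proj₁ (positive-rank p∈)) q∈))
  where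
  positive-rank : ∀ {p} → p ∈ˡ filter 𝒫⁺? ps → p ∈ˡ ps × p ∈ 𝒫⁺
  positive-rank = ∈-filter⁻ 𝒫⁺? {xs = ps}
  cover : ∀ {q} → q ∈ˡ ps → ∃[ p ] p ∈ˡ filter 𝒫⁺? ps × q ∈ Class p
  cover {q} q∈ = p , ∈-filter⁺ 𝒫⁺? (closed {q} {p} q∈ p∈) (λ {i} → p⁺ {i}) , class-sym {q} {p} p∈
    where
    p : Partition
    p = proj₁ (class-𝒫⁺ q)
    p∈ : p ∈ Class q
    p∈ = proj₁ (proj₁ (proj₂ (class-𝒫⁺ q)))
    p⁺ : p ∈ 𝒫⁺
    p⁺ = proj₂ (proj₁ (proj₂ (class-𝒫⁺ q)))

sum-classesOf : ∀ n → sum (map (λ p → 2 ^ κ p) (filter 𝒫⁺? (partitionsOf n))) ≡ length (partitionsOf n)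
sum-classesOf n = sum-classes (partitionsOf-unique n) (λ {p} {q} p∈ q∈ →
  from (∈-partitionsOf {n} {q}) (trans (class-size p q∈) (to (∈-partitionsOf {n} {p}) p∈)))

-- Power series

sumℤ-cong : ∀ {f g} n → (∀ {k} → k < n → f k ≡ g k) → sumℤ (applyUpTo f n) ≡ sumℤ (applyUpTo g n)
sumℤ-cong zero    eq = refl
sumℤ-cong (suc n) eq = cong₂ ℤ._+_ (eq (s≤s z≤n)) (sumℤ-cong n (eq ∘ s≤s))

sumℤ-last : ∀ f n → sumℤ (applyUpTo f (suc n)) ≡ sumℤ (applyUpTo f n) ℤ.+ f n
sumℤ-last f zero    = ℤ.+-comm (f 0) 0ℤ
sumℤ-last f (suc n) = trans (cong (λ z → f 0 ℤ.+ z) (sumℤ-last (f ∘ suc) n)) (sym (ℤ.+-assoc (f 0) _ _))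

sumℤ-minus : ∀ f g n → sumℤ (applyUpTo (λ k → f k ℤ.- g k) n) ≡ sumℤ (applyUpTo f n) ℤ.- sumℤ (applyUpTo g n)
sumℤ-minus f g zero    = refl
sumℤ-minus f g (suc n) = trans (cong (λ z → f 0 ℤ.- g 0 ℤ.+ z) (sumℤ-minus (f ∘ suc) (g ∘ suc) n))
  (solve 4 (λ a b x y → a :- b :+ (x :- y) := a :+ x :- (b :+ y)) refl (f 0) (g 0) _ _)
  where open +-*-Solver

infixl 6 _⊝_

_⊝_ : PowerSeries → PowerSeries → PowerSeries
(f ⊝ g) n = f n ℤ.- g n

⊝-cong : ∀ {f f′ g g′} → f ≗ f′ → g ≗ g′ → f ⊝ g ≗ f′ ⊝ g′
⊝-cong f≗ g≗ n = cong₂ ℤ._-_ (f≗ n) (g≗ n)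

⊛-cong-≤ : ∀ {f f′ g g′ n} → (∀ {k} → k ≤ n → f k ≡ f′ k) → (∀ {k} → k ≤ n → g k ≡ g′ k) →
           (f ⊛ g) n ≡ (f′ ⊛ g′) n
⊛-cong-≤ {n = n} f≡ g≡ = sumℤ-cong (suc n) (λ {k} k<1+n → cong₂ ℤ._*_ (f≡ (s≤s⁻¹ k<1+n)) (g≡ (m∸n≤m n k)))

⊛-congˡ : ∀ {f g h} → g ≗ h → f ⊛ g ≗ f ⊛ h
⊛-congˡ {f} {g} {h} g≗h n = ⊛-cong-≤ {f} {f} {g} {h} {n} (λ _ → refl) (λ {k} _ → g≗h k)

⊛-congʳ : ∀ {f g h} → f ≗ g → f ⊛ h ≗ g ⊛ h
⊛-congʳ {f} {g} {h} f≗g n = ⊛-cong-≤ {f} {g} {h} {h} {n} (λ {k} _ → f≗g k) (λ _ → refl)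

⊛-⊝ : ∀ f g h → f ⊛ (g ⊝ h) ≗ f ⊛ g ⊝ f ⊛ h
⊛-⊝ f g h n = trans (sumℤ-cong (suc n) (λ {k} _ → x[y-z]≈xy-xz (f k) (g (n ∸ k)) (h (n ∸ k))))
  (sumℤ-minus (λ k → f k ℤ.* g (n ∸ k)) (λ k → f k ℤ.* h (n ∸ k)) (suc n))

⊝-⊛ : ∀ f g h → (f ⊝ g) ⊛ h ≗ f ⊛ h ⊝ g ⊛ h
⊝-⊛ f g h n = trans (sumℤ-cong (suc n) (λ {k} _ → [y-z]x≈yx-zx (h (n ∸ k)) (f k) (g k)))
  (sumℤ-minus (λ k → f k ℤ.* h (n ∸ k)) (λ k → g k ℤ.* h (n ∸ k)) (suc n))

⊛-identityʳ : ∀ f → f ⊛ (q^ 0) ≗ f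
⊛-identityʳ f n = trans
  (sumℤ-head (λ k → f k ℤ.* (q^ 0) (n ∸ k)) n
    (λ k k<n → trans (cong (f k ℤ.*_) (q^-≢ {0} (m>n⇒m∸n≢0 k<n))) (ℤ.*-zeroʳ (f k))))
  (trans (cong (λ m → f n ℤ.* (q^ 0) m) (n∸n≡0 n)) (ℤ.*-identityʳ (f n)))

-- Multiplication by q.
shift : PowerSeries → PowerSeries
shift f zero    = 0ℤ
shift f (suc n) = f n

shift-cong : ∀ {f g} → f ≗ g → shift f ≗ shift g
shift-cong f≗g zero    = refl
shift-cong f≗g (suc n) = f≗g n

shift-⊛ : ∀ f g → shift f ⊛ g ≗ shift (f ⊛ g)
shift-⊛ f g zero    = refl
shift-⊛ f g (suc n) = ℤ.+-identityˡ _

⊛-shift : ∀ f g → f ⊛ shift g ≗ shift (f ⊛ g)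
⊛-shift f g zero    = trans (ℤ.+-identityʳ _) (ℤ.*-zeroʳ (f 0))
⊛-shift f g (suc n) = begin
  S (suc (suc n))                    ≡⟨ sumℤ-last term (suc n) ⟩
  -- The last term contains the constant coefficient of `shift g`, which is 0.
  S (suc n) ℤ.+ term (suc n)         ≡⟨ cong (λ m → S (suc n) ℤ.+ f (suc n) ℤ.* shift g m) (n∸n≡0 n) ⟩
  S (suc n) ℤ.+ f (suc n) ℤ.* 0ℤ     ≡⟨ cong (λ z → S (suc n) ℤ.+ z) (ℤ.*-zeroʳ (f (suc n))) ⟩
  S (suc n) ℤ.+ 0ℤ                   ≡⟨ ℤ.+-identityʳ (S (suc n)) ⟩
  S (suc n)                          ≡⟨ sumℤ-cong (suc n) (λ {k} k≤n → cong (λ m → f k ℤ.* shift g m)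
                                          (+-∸-assoc 1 (s≤s⁻¹ k≤n))) ⟩
  (f ⊛ g) n                          ∎
  where
  open ≡-Reasoning
  term : ℕ → ℤ
  term k = f k ℤ.* shift g (suc n ∸ k)
  S : ℕ → ℤ
  S k = sumℤ (applyUpTo term k)

shifts : ℕ → PowerSeries → PowerSeries
shifts zero    f = f
shifts (suc j) f = shift (shifts j f)

shifts-cong : ∀ j {f g} → f ≗ g → shifts j f ≗ shifts j g
shifts-cong zero    f≗g = f≗g
shifts-cong (suc j) f≗g = shift-cong (shifts-cong j f≗g)

shifts-⊛ : ∀ j f g → shifts j f ⊛ g ≗ shifts j (f ⊛ g)
shifts-⊛ zero    f g n = refl
shifts-⊛ (suc j) f g n = trans (shift-⊛ (shifts j f) g n) (shift-cong (shifts-⊛ j f g) n)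

⊛-shifts : ∀ j f g → f ⊛ shifts j g ≗ shifts j (f ⊛ g)
⊛-shifts zero    f g n = refl
⊛-shifts (suc j) f g n = trans (⊛-shift f (shifts j g) n) (shift-cong (⊛-shifts j f g) n)

shifts-< : ∀ j f {n} → n < j → shifts j f n ≡ 0ℤ
shifts-< (suc j) f {zero}  n<j       = refl
shifts-< (suc j) f {suc n} (s≤s n<j) = shifts-< j f n<j

shifts-+ : ∀ j f n → shifts j f (j + n) ≡ f n
shifts-+ zero    f n = refl
shifts-+ (suc j) f n = shifts-+ j f n

q^-shifts : ∀ j → q^ j ≗ shifts j (q^ 0)
q^-shifts zero    n       = refl
q^-shifts (suc j) zero    = refl
q^-shifts (suc j) (suc n) = q^-shifts j n

⊛-1-q^-shifts : ∀ f j → f ⊛ (1-q^ j) ≗ f ⊝ shifts j f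
⊛-1-q^-shifts f j n = trans (⊛-⊝ f (q^ 0) (q^ j) n) (⊝-cong (⊛-identityʳ f)
  (λ m → trans (⊛-congˡ {f} (q^-shifts j) m) (trans (⊛-shifts j f (q^ 0) m) (shifts-cong j (⊛-identityʳ f) m))) n)

-- A shift can be pulled out of either factor, so both sides are `f ⊛ g` minus its shift by `j`.
-- This brings the newest factor of `⟨q⟩` next to the counting series.
⊛-1-q^-swap : ∀ f g j → f ⊛ (g ⊛ (1-q^ j)) ≗ (f ⊛ (1-q^ j)) ⊛ g
⊛-1-q^-swap f g j n = begin
  (f ⊛ (g ⊛ (1-q^ j))) n          ≡⟨ ⊛-congˡ {f} (⊛-1-q^-shifts g j) n ⟩
  (f ⊛ (g ⊝ shifts j g)) n        ≡⟨ ⊛-⊝ f g (shifts j g) n ⟩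
  (f ⊛ g ⊝ f ⊛ shifts j g) n      ≡⟨ cong (λ z → (f ⊛ g) n ℤ.- z) (trans (⊛-shifts j f g n) (sym (shifts-⊛ j f g n))) ⟩
  (f ⊛ g ⊝ shifts j f ⊛ g) n      ≡⟨ ⊝-⊛ f (shifts j f) g n ⟨
  ((f ⊝ shifts j f) ⊛ g) n        ≡⟨ ⊛-congʳ {h = g} (⊛-1-q^-shifts f j) n ⟨
  ((f ⊛ (1-q^ j)) ⊛ g) n          ∎
  where open ≡-Reasoning

-- Euler's product for the number of partitions with bounded parts

boundedParts : ℕ → ℕ → List (List ℕ)
boundedParts m n = filter (All.all? (_≤? m)) (map parts (partitionsOf n))

boundedParts-unique : ∀ m n → Unique (boundedParts m n)
boundedParts-unique m n = Unique.filter⁺ (All.all? (_≤? m)) (Unique.map⁺ parts-injective (partitionsOf-unique n))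

BoundedPartition : ℕ → ℕ → Pred (List ℕ) 0ℓ
BoundedPartition m n xs = (Linked _≥_ xs × All (0 <_) xs × sum xs ≡ n) × All (_≤ m) xs

∈-boundedParts : ∀ m n {xs} → xs ∈ˡ boundedParts m n ⇔ xs ∈ BoundedPartition m n
∈-boundedParts m n {xs} = mk⇔
  (λ xs∈ → let xs∈p , xs≤m = ∈-filter⁻ (All.all? (_≤? m)) {xs = map parts (partitionsOf n)} xs∈
           in partition xs∈p , xs≤m)
  (λ ((xs↘ , 0<xs , sum≡n) , xs≤m) → ∈-filter⁺ (All.all? (_≤? m))
    (∈-map⁺ parts {x = mkPartition xs xs↘ 0<xs} (from (∈-partitionsOf {n}) sum≡n)) xs≤m)
  where
  partition : ∀ {xs} → xs ∈ˡ map parts (partitionsOf n) → Linked _≥_ xs × All (0 <_) xs × sum xs ≡ n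
  partition xs∈ with ∈-map⁻ parts xs∈
  ... | p , p∈ , refl = decreasing p , positive p , to (∈-partitionsOf {n} {p}) p∈

boundedParts-zero : ∀ n → ℤ.+ length (boundedParts 0 n) ≡ (q^ 0) n
boundedParts-zero zero = cong ℤ.+_ (unique-length (boundedParts-unique 0 0) ([] ∷ []) (λ {xs} → mk⇔
  (empty xs ∘ to (∈-boundedParts 0 0))
  (λ { (here refl) → from (∈-boundedParts 0 0) (([] , [] , refl) , []) })))
  where
  empty : ∀ xs → xs ∈ BoundedPartition 0 0 → xs ∈ˡ [] ∷ []
  empty []       _                                 = here refl
  empty (x ∷ xs) ((_ , (0<x ∷ _) , _) , (x≤0 ∷ _)) = contradiction x≤0 (<⇒≱ 0<x)
boundedParts-zero (suc n) = cong ℤ.+_ (unique-length {ys = []} (boundedParts-unique 0 (suc n)) [] (λ {xs} → mk⇔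
  (λ xs∈ → contradiction (to (∈-boundedParts 0 (suc n)) xs∈) (none xs)) (λ ())))
  where
  none : ∀ xs → xs ∉ BoundedPartition 0 (suc n)
  none []       ((_ , _ , ()) , _)
  none (x ∷ xs) ((_ , (0<x ∷ _) , _) , (x≤0 ∷ _)) = contradiction x≤0 (<⇒≱ 0<x)

-- A part never exceeds the sum `n`, hence never exceeds `m`.
boundedParts-small : ∀ {m n} → n ≤ m → length (boundedParts (suc m) n) ≡ length (boundedParts m n)
boundedParts-small {m} {n} n≤m = unique-length
  (boundedParts-unique (suc m) n) (boundedParts-unique m n) (λ {xs} → mk⇔
  (λ xs∈ → let (xs↘ , 0<xs , sum≡n) , _ = to (∈-boundedParts (suc m) n) xs∈ in
    from (∈-boundedParts m n) ((xs↘ , 0<xs , sum≡n) ,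
      All.map (λ x≤ → ≤-trans x≤ (≤-trans (≤-reflexive sum≡n) n≤m)) (all≤sum xs)))
  (λ xs∈ → let p , xs≤m = to (∈-boundedParts m n) xs∈ in from (∈-boundedParts (suc m) n) (p , All.map m≤n⇒m≤1+n xs≤m)))

cons-linked : ∀ {m xs} → Linked _≥_ xs → All (_≤ m) xs → Linked _≥_ (m ∷ xs)
cons-linked []      []      = [-]
cons-linked [-]       (x≤m ∷ _) = x≤m ∷ [-]
cons-linked (r ∷ rs)  (x≤m ∷ _) = x≤m ∷ r ∷ rs

linked-bounded : ∀ {x xs} → Linked _≥_ (x ∷ xs) → All (_≤ x) xs
linked-bounded [-]       = []
linked-bounded (x≥y ∷ l) = Linked.Linked⇒All (λ a≥b b≥c → ≤-trans b≥c a≥b) x≥y l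

-- Either the first part is at most `m`, or it equals `suc m` and can be removed, leaving a
-- partition of `n`.
boundedParts-suc : ∀ m n → length (boundedParts (suc m) (suc m + n)) ≡
                   length (boundedParts m (suc m + n)) + length (boundedParts (suc m) n)
boundedParts-suc m n = begin
  length all                                    ≡⟨ unique-length (boundedParts-unique (suc m) (suc m + n)) both!
    (mk⇔ (λ xs∈ → split _ (to (∈-boundedParts (suc m) (suc m + n)) xs∈)) ([ weaken , extend ]′ ∘ ∈-++⁻ small)) ⟩
  length (small ++ map (suc m ∷_) large)        ≡⟨ List.length-++ small ⟩
  length small + length (map (suc m ∷_) large)  ≡⟨ cong (length small +_) (List.length-map (suc m ∷_) large) ⟩
  length small + length large                   ∎
  where
  open ≡-Reasoning
  all small large : List (List ℕ)
  all   = boundedParts (suc m) (suc m + n)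
  small = boundedParts m (suc m + n)
  large = boundedParts (suc m) n
  disjoint : ∀ {xs} → ¬ (xs ∈ˡ small × xs ∈ˡ map (suc m ∷_) large)
  disjoint (xs∈ , xs∈′) with ∈-map⁻ (suc m ∷_) xs∈′
  ... | _ , _ , refl with to (∈-boundedParts m (suc m + n)) xs∈
  ...   | _ , (1+m≤m ∷ _) = 1+n≰n 1+m≤m
  both! : Unique (small ++ map (suc m ∷_) large)
  both! = Unique.++⁺ (boundedParts-unique m (suc m + n))
    (Unique.map⁺ List.∷-injectiveʳ (boundedParts-unique (suc m) n)) disjoint
  split : ∀ xs → xs ∈ BoundedPartition (suc m) (suc m + n) → xs ∈ˡ small ++ map (suc m ∷_) large
  split []       ((_ , _ , ()) , _)
  split (x ∷ xs) ((xs↘ , 0<xs , sum≡) , (x≤ ∷ xs≤)) with m≤n⇒m<n∨m≡n x≤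
  -- The head is the largest part, so its bound passes to all parts.
  ... | inj₁ x<1+m = ∈-++⁺ˡ (from (∈-boundedParts m (suc m + n)) ((xs↘ , 0<xs , sum≡) ,
    (s≤s⁻¹ x<1+m ∷ All.map (λ y≤x → ≤-trans y≤x (s≤s⁻¹ x<1+m)) (linked-bounded xs↘))))
  ... | inj₂ refl = ∈-++⁺ʳ small (∈-map⁺ (suc m ∷_) (from (∈-boundedParts (suc m) n)
    ((Linked.tail xs↘ , All.tail 0<xs , +-cancelˡ-≡ (suc m) (sum xs) n sum≡) , xs≤)))
  weaken : ∀ {xs} → xs ∈ˡ small → xs ∈ˡ all
  weaken xs∈ = let p , xs≤m = to (∈-boundedParts m (suc m + n)) xs∈ in
    from (∈-boundedParts (suc m) (suc m + n)) (p , All.map m≤n⇒m≤1+n xs≤m)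
  extend : ∀ {xs} → xs ∈ˡ map (suc m ∷_) large → xs ∈ˡ all
  extend xs∈ with ∈-map⁻ (suc m ∷_) xs∈
  ... | ys , ys∈ , refl with to (∈-boundedParts (suc m) n) ys∈
  ...   | (ys↘ , 0<ys , sum≡n) , ys≤ = from (∈-boundedParts (suc m) (suc m + n))
    ((cons-linked ys↘ ys≤ , (s≤s z≤n ∷ 0<ys) , cong (suc m +_) sum≡n) , (≤-refl ∷ ys≤))

boundedSeries : ℕ → PowerSeries
boundedSeries m n = ℤ.+ length (boundedParts m n)

-- Below degree `suc m` the shifted series vanishes and the two counts agree; from there on this is
-- the recurrence `boundedParts-suc`.
boundedSeries-suc : ∀ m → boundedSeries (suc m) ⊝ shifts (suc m) (boundedSeries (suc m)) ≗ boundedSeries m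
boundedSeries-suc m n with n <? suc m
... | yes n<1+m = trans (cong (λ z → boundedSeries (suc m) n ℤ.- z) (shifts-< (suc m) (boundedSeries (suc m)) n<1+m))
  (trans (ℤ.+-identityʳ _) (cong ℤ.+_ (boundedParts-small (s≤s⁻¹ n<1+m))))
... | no  n≮1+m = subst (λ n → (boundedSeries (suc m) ⊝ shifts (suc m) (boundedSeries (suc m))) n ≡ boundedSeries m n)
  (m+[n∸m]≡n (≮⇒≥ n≮1+m)) (large (n ∸ suc m))
  where
  large : ∀ k → (boundedSeries (suc m) ⊝ shifts (suc m) (boundedSeries (suc m))) (suc m + k) ≡
          boundedSeries m (suc m + k)
  large k = begin
    boundedSeries (suc m) (suc m + k) ℤ.- shifts (suc m) (boundedSeries (suc m)) (suc m + k)
      ≡⟨ cong₂ ℤ._-_ (cong ℤ.+_ (boundedParts-suc m k)) (shifts-+ (suc m) (boundedSeries (suc m)) k) ⟩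
    (boundedSeries m (suc m + k) ℤ.+ boundedSeries (suc m) k) ℤ.- boundedSeries (suc m) k
      ≡⟨ ℤ.+-assoc (boundedSeries m (suc m + k)) (boundedSeries (suc m) k) (ℤ.- boundedSeries (suc m) k) ⟩
    boundedSeries m (suc m + k) ℤ.+ (boundedSeries (suc m) k ℤ.- boundedSeries (suc m) k)
      ≡⟨ cong (λ z → boundedSeries m (suc m + k) ℤ.+ z) (ℤ.+-inverseʳ (boundedSeries (suc m) k)) ⟩
    boundedSeries m (suc m + k) ℤ.+ 0ℤ
      ≡⟨ ℤ.+-identityʳ _ ⟩
    boundedSeries m (suc m + k) ∎
    where open ≡-Reasoning

-- Each factor `1-q^ suc m` lowers the bound on the parts by one, until only the empty partition
-- remains.
boundedSeries-product : ∀ m → boundedSeries m ⊛ ⟨q⟩ m ≗ q^ 0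
boundedSeries-product zero    n = trans (⊛-identityʳ (boundedSeries 0) n) (boundedParts-zero n)
boundedSeries-product (suc m) n = begin
  (boundedSeries (suc m) ⊛ (⟨q⟩ m ⊛ (1-q^ suc m))) n    ≡⟨ ⊛-1-q^-swap (boundedSeries (suc m)) (⟨q⟩ m) (suc m) n ⟩
  ((boundedSeries (suc m) ⊛ (1-q^ suc m)) ⊛ ⟨q⟩ m) n    ≡⟨ ⊛-congʳ {h = ⟨q⟩ m} (λ k →
    trans (⊛-1-q^-shifts (boundedSeries (suc m)) (suc m) k) (boundedSeries-suc m k)) n ⟩
  (boundedSeries m ⊛ ⟨q⟩ m) n                           ≡⟨ boundedSeries-product m n ⟩
  (q^ 0) n                                              ∎
  where open ≡-Reasoning

boundedParts-all : ∀ {m n} → n ≤ m → length (boundedParts m n) ≡ length (partitionsOf n)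
boundedParts-all {m} {n} n≤m = trans
  (cong length (List.filter-all (All.all? (_≤? m)) (All.map⁺ (All.tabulate bounded))))
  (List.length-map parts (partitionsOf n))
  where
  bounded : ∀ {p} → p ∈ˡ partitionsOf n → All (_≤ m) (parts p)
  bounded {p} p∈ = All.map
    (λ x≤ → ≤-trans x≤ (≤-trans (≤-reflexive (to (∈-partitionsOf {n} {p}) p∈)) n≤m)) (all≤sum (parts p))

-- The coefficient at `n` involves only coefficients up to `n`. There the series counts partitions
-- with parts at most `n` and `⟨q⟩∞` agrees with `⟨q⟩ n`, so the finite product identity applies.
generating-function : 𝒫⁺-series ⊛ ⟨q⟩∞ ≗ q^ 0
generating-function n = begin
  (𝒫⁺-series ⊛ ⟨q⟩∞) n         ≡⟨ ⊛-cong-≤ {𝒫⁺-series} {boundedSeries n} {⟨q⟩∞} {⟨q⟩ n} {n}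
    (λ {k} k≤n → cong ℤ.+_ (trans (sum-classesOf k) (sym (boundedParts-all {n} {k} k≤n))))
    (λ k≤n → sym (⟨q⟩-stable k≤n)) ⟩
  (boundedSeries n ⊛ ⟨q⟩ n) n  ≡⟨ boundedSeries-product n n ⟩
  (q^ 0) n                     ∎
  where open ≡-Reasoning

theorem4p3 : ((∀ p → p ∈ Class p) × (∀ p r → (Class p ≐ Class r) ⊎ (Class p ⊥ Class r)))
    × (∀ p → Boolean p)
    × (∀ p → HasCardinality (Class p) (2 ^ κ p))
    × (∀ p {r} → r ∈ Class p → size r ≡ size p)
    × (∀ p → ∃! _≡_ (Class p ∩ 𝒫⁺))
    × (𝒫⁺-series ⊛ ⟨q⟩∞ ≗ q^ 0)
theorem4p3 =
  (class-refl , class-dichotomy) , boolean , class-cardinality , class-size , class-𝒫⁺ , generating-function
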